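{- For every integer $n\ge1$, the number of tatami tilings of the $n\times n$ grid with exactly $n$ monomers is $T(n,n,n)=n2^{n-1}$.
   Context: A tatami tiling of the $r\times c$ rectangular grid is a tiling by monomers ($1\times1$ tiles) and dimers ($1\times2$ or $2\times1$ tiles) such that no point is a corner of four distinct tiles. $T(r,c,m)$ denotes the number of tatami tilings of the $r\times c$ grid with exactly $m$ monomers. -}

module Defs where

open import Data.List.Base
  using (List; []; _∷_; _++_; map; filter; length; upTo; cartesianProduct; cartesianProductWith)
open import Data.List.Relation.Unary.All using (All; all?)
open import Data.Nat.Base using (ℕ; suc; _+_; _≤_; _<_)
open import Data.Nat.Properties using (_≟_; _≤?_; _<?_)
open import Data.Product.Base using (_×_; _,_)
open import Data.Sum.Base using (_⊎_)
open import Level using (Level)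
open import Relation.Binary.PropositionalEquality.Core using (_≡_; refl)
open import Relation.Nullary.Decidable using (yes; no; _×-dec_; _⊎-dec_)
open import Relation.Unary using (Pred; Decidable)

private
  variable
    a p : Level
    A : Set a

count : {P : Pred A p} → Decidable P → List A → ℕ
count P? xs = length (filter P? xs)

-- The 2 ^ length xs subsequences of xs, one for each choice of positions.
-- When xs has no repetitions these are the subsets of xs, each listed once.
subsets : List A → List (List A)
subsets []       = [] ∷ []
subsets (x ∷ xs) = map (x ∷_) (subsets xs) ++ subsets xs

data Shape : Set where
  monomer horizontalDimer verticalDimer : Shape

height width : Shape → ℕ
height monomer         = 1
height horizontalDimer = 1
height verticalDimer   = 2
width monomer         = 1
width horizontalDimer = 2
width verticalDimer   = 1

shapes : List Shape
shapes = monomer ∷ horizontalDimer ∷ verticalDimer ∷ []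

-- Cell (i , j) is the unit square [i , i + 1] × [j , j + 1], rows first.
Cell Point : Set
Cell  = ℕ × ℕ
Point = ℕ × ℕ

cells points : ℕ → ℕ → List (ℕ × ℕ)
cells  r c = cartesianProduct (upTo r) (upTo c)
points r c = cells (suc r) (suc c)

-- The tile occupies [top , top + height] × [left , left + width].
record Tile : Set where
  constructor tile
  field
    top left : ℕ
    shape    : Shape

  bottom right : ℕ
  bottom = top + height shape
  right  = left + width shape

open Tile public

Fits : ℕ → ℕ → Tile → Set
Fits r c t = bottom t ≤ r × right t ≤ c

Covers : Cell → Tile → Set
Covers (i , j) t = (top t ≤ i × i < bottom t) × (left t ≤ j × j < right t)

HasCorner : Point → Tile → Set
HasCorner (x , y) t = (x ≡ top t ⊎ x ≡ bottom t) × (y ≡ left t ⊎ y ≡ right t)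

IsMonomer : Tile → Set
IsMonomer t = shape t ≡ monomer

fits? : ∀ r c → Decidable (Fits r c)
fits? r c t = (bottom t ≤? r) ×-dec (right t ≤? c)

covers? : ∀ q → Decidable (Covers q)
covers? (i , j) t =
  ((top t ≤? i) ×-dec (i <? bottom t)) ×-dec ((left t ≤? j) ×-dec (j <? right t))

hasCorner? : ∀ q → Decidable (HasCorner q)
hasCorner? (x , y) t =
  ((x ≟ top t) ⊎-dec (x ≟ bottom t)) ×-dec ((y ≟ left t) ⊎-dec (y ≟ right t))

isMonomer? : Decidable IsMonomer
isMonomer? (tile _ _ monomer)         = yes refl
isMonomer? (tile _ _ horizontalDimer) = no λ ()
isMonomer? (tile _ _ verticalDimer)   = no λ ()

-- All tiles inside the r × c grid, without repetition.
placements : ℕ → ℕ → List Tile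
placements r c =
  filter (fits? r c)
    (cartesianProductWith (λ (i , j) s → tile i j s) (cells r c) shapes)

-- The predicates below are used only for members of subsets (placements r c),
-- in which the tiles are distinct and lie inside the grid.

IsTiling : ℕ → ℕ → List Tile → Set
IsTiling r c ts = All (λ q → count (covers? q) ts ≡ 1) (cells r c)

-- All corners of tiles inside the grid are among points r c.
IsTatami : ℕ → ℕ → List Tile → Set
IsTatami r c ts = All (λ q → count (hasCorner? q) ts < 4) (points r c)

IsTatamiTiling : (r c m : ℕ) → List Tile → Set
IsTatamiTiling r c m ts =
  IsTiling r c ts × IsTatami r c ts × count isMonomer? ts ≡ m

isTatamiTiling? : ∀ r c m → Decidable (IsTatamiTiling r c m)
isTatamiTiling? r c m ts =
  all? (λ q → count (covers? q) ts ≟ 1) (cells r c) ×-dec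
  all? (λ q → count (hasCorner? q) ts <? 4) (points r c) ×-dec
  (count isMonomer? ts ≟ m)

-- The number of tatami tilings of the r × c grid with exactly m monomers.
T : ℕ → ℕ → ℕ → ℕ
T r c m = count (isTatamiTiling? r c m) (subsets (placements r c))

{-# OPTIONS --safe #-}

-- Let n = M + 2 and call a unit segment from an interior grid point that runs along
-- the middle of a dimer an arm.  The tatami condition says that every interior grid
-- point has an arm, and an arm pointing down or right at v forbids arms pointing up
-- or left at the next point on the diagonal of v.  Counting every dimer at its end
-- nearer to the main antidiagonal, and grouping the interior points into pairs
-- symmetric about that antidiagonal, each pair contributes at least 1, so there are
-- at least n(n − 1)/2 dimers and at most n monomers.  With n monomers each pair
-- contributes exactly 1.  Then every point has exactly one arm, and whether it points
-- down or right depends only on the diagonal of the point; a 2 × 2 block of points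
-- shows that whether it points down or left depends only on the antidiagonal.
--
-- So the tilings are pairs of bit sequences, h on the antidiagonals and g on the
-- diagonals.  After a checkerboard twist the local rules say that h may toggle only
-- where the crossing part of g is constant with a prescribed value, and conversely.
-- Hence the two central values decide at which of the two steps at distance p from
-- the centre each sequence may toggle, and toggles of h at distance p and of g at
-- distance q need p + q ≥ M.  There are 4 (M + 2) 2^(M − 1) such data.
module Submission where

open import Defs
open import Data.Bool.Base using (Bool; true; false; not; _∧_; _∨_; _xor_; if_then_else_)
open import Data.Bool.Properties using (not-involutive; not-¬; ∧-zeroʳ; ∧-comm) renaming (_≟_ to _≟ᵇ_)
open import Data.Empty using (⊥; ⊥-elim)
open import Data.List.Base
  using (List; []; _∷_; _++_; map; filter; length; upTo; applyUpTo; cartesianProduct; cartesianProductWith)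
open import Data.List.Properties using (length-map; length-++; filter-accept; filter-reject; filter-++)
import Data.List.Membership.DecPropositional as DecMembership
open import Data.List.Membership.Propositional using (_∈_)
open import Data.List.Membership.Propositional.Properties
open import Data.List.Relation.Unary.All as All using (All; []; _∷_)
import Data.List.Relation.Unary.All.Properties as All
open import Data.List.Relation.Unary.AllPairs using ([]; _∷_)
open import Data.List.Relation.Unary.Any using (here; there)
open import Data.List.Relation.Unary.Unique.Propositional using (Unique)
import Data.List.Relation.Unary.Unique.Propositional.Properties as Unique
open import Data.Nat.Base
  using (ℕ; zero; suc; _+_; _*_; _∸_; _^_; _⊔_; _⊓_; _≤_; _<_; _≥_; z≤n; s≤s; s≤s⁻¹)
open import Data.Nat.Properties
open import Data.Nat.Tactic.RingSolver using (solve-∀)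
open import Data.Product.Base using (_×_; _,_; proj₁; proj₂; ∃)
open import Data.Sum.Base using (_⊎_; inj₁; inj₂; [_,_]′)
open import Data.Unit.Base using (tt)
open import Data.Vec.Base using (Vec; []; _∷_)
open import Data.Vec.Properties using (∷-injective)
open import Relation.Binary.Definitions using (DecidableEquality)
open import Relation.Binary.PropositionalEquality
open import Relation.Nullary using (¬_; Dec; contradiction; yes; no; does; ¬?)
open import Relation.Nullary.Decidable using (toWitness; dec-true; _×-dec_; _→-dec_)
open import Relation.Unary using (Decidable)

-- Sequences that toggle at prescribed distances from the centre

-- In the coordinates d = y - x and e = x + y - M the interior points are the pairs of the right
-- parity with |d| + |e| ≤ M. Where dimers form a brick pattern, h and g alternate at every step;
-- the twist makes them constant there, so a toggle marks a break of the pattern. Suppose that g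
-- toggles between the diagonals d = q and d = q + 1. The points of these two diagonals form a
-- staircase, and the rules prescribe h at each of them. Parity and direction of the steps alternate
-- together, so it is always the same value, forced on every antidiagonal with |e| ≤ M - q. The
-- antidiagonal e = 0 is always among these, and a toggle on the opposite side would prescribe the
-- opposite value there: so the central value of h decides on which side g may toggle. Moreover h
-- cannot toggle at a distance p with p + 1 ≤ M - q, which is the condition p + q ≥ M. The
-- reflection y ↦ M - y exchanges the roles of g and h.

odd : ℕ → Bool
odd zero    = false
odd (suc n) = not (odd n)

odd-+ : ∀ m n → odd (m + n) ≡ odd m xor odd n
odd-+ zero    n = refl
odd-+ (suc m) n rewrite odd-+ m n with odd m | odd n
... | true  | true  = refl
... | true  | false = refl
... | false | true  = refl
... | false | false = refl

odd-+-suc : ∀ m n → odd (m + suc n) ≡ not (odd (m + n))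
odd-+-suc m n rewrite +-suc m n = refl

-- φ c u ch x y depends only on the signed difference y − x.  It equals c at
-- difference 0 and toggles between absolute differences q and q + 1 when ch q
-- holds, on the side y > x if odd q is u and on the side x > y otherwise.
φ : Bool → Bool → (ℕ → Bool) → ℕ → ℕ → Bool
φ c u ch zero    zero    = c
φ c u ch zero    (suc y) = φ c u ch zero y xor (ch y ∧ not (odd y xor u))
φ c u ch (suc x) zero    = φ c u ch x zero xor (ch x ∧ (odd x xor u))
φ c u ch (suc x) (suc y) = φ c u ch x y

-- Transposition negates the difference y - x and so exchanges the two sides, which is also the
-- effect of negating `u`. Vertical steps are thereby reduced to horizontal ones.
φ-transpose : ∀ c u ch x y → φ c u ch x y ≡ φ c (not u) ch y x
φ-transpose c u ch zero    zero    = refl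
φ-transpose c u ch zero    (suc y) rewrite φ-transpose c u ch zero y with odd y | u
... | true  | true  = refl
... | true  | false = refl
... | false | true  = refl
... | false | false = refl
φ-transpose c u ch (suc x) zero    rewrite φ-transpose c u ch x zero with odd x | u
... | true  | true  = refl
... | true  | false = refl
... | false | true  = refl
... | false | false = refl
φ-transpose c u ch (suc x) (suc y) = φ-transpose c u ch x y

φ-near : ∀ c u ch δ x y → (∀ q → q < δ → ch q ≡ false) → x ≤ y + δ → y ≤ x + δ →
         φ c u ch x y ≡ c
φ-near c u ch δ zero    zero    off x≤ y≤ = refl
φ-near c u ch δ zero    (suc y) off x≤ y≤
  rewrite off y y≤ | φ-near c u ch δ zero y off z≤n (<⇒≤ y≤) with c
... | true  = refl
... | false = refl
φ-near c u ch δ (suc x) zero    off x≤ y≤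
  rewrite off x x≤ | φ-near c u ch δ x zero off (<⇒≤ x≤) z≤n with c
... | true  = refl
... | false = refl
φ-near c u ch δ (suc x) (suc y) off x≤ y≤ = φ-near c u ch δ x y off (s≤s⁻¹ x≤) (s≤s⁻¹ y≤)

xor-toggle : ∀ {b} t → b ≢ b xor t → t ≡ true
xor-toggle             true  _ = refl
xor-toggle {true}  false b≢ = contradiction refl b≢
xor-toggle {false} false b≢ = contradiction refl b≢

∧-split : ∀ {s t} → s ∧ t ≡ true → s ≡ true × t ≡ true
∧-split {true} {true} refl = refl , refl

-- The side rule of `φ` is made so that every horizontal change starts at a point of parity `u`, on
-- either side of the main diagonal. If x and y + 1 are at most M, the bounds give index < M and
-- index ≤ s ≤ 2M - index for both sums s = x + y and s = x + y + 1.
record Toggle (u : Bool) (ch : ℕ → Bool) (x y : ℕ) : Set where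
  field
    odd≡ : odd (x + y) ≡ u
    index   : ℕ
    on      : ch index ≡ true
    index≤  : index ≤ x + y
    index<  : index < x ⊔ suc y
    sum≤    : x + suc y + index ≤ (x ⊔ suc y) + (x ⊔ suc y)

φ-toggle : ∀ c u ch x y → φ c u ch x y ≢ φ c u ch x (suc y) → Toggle u ch x y
φ-toggle c u ch zero y F≢ = record
  { odd≡ = lem (odd y) u (proj₂ both)
  ; index = y ; on = proj₁ both ; index≤ = ≤-refl ; index< = ≤-refl
  ; sum≤ = +-monoʳ-≤ (suc y) (n≤1+n y) }
  where
  both = ∧-split (xor-toggle _ F≢)
  lem : ∀ p u → not (p xor u) ≡ true → p ≡ u
  lem true  true  _ = refl
  lem false false _ = refl
φ-toggle c u ch (suc x) zero F≢ = record
  { odd≡ = trans (cong (λ z → not (odd z)) (+-identityʳ x)) (lem (odd x) u (proj₂ both))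
  ; index = x ; on = proj₁ both
  ; index≤ = ≤-trans (n≤1+n x) (m≤m+n (suc x) 0)
  ; index< = m≤m⊔n (suc x) 1
  ; sum≤ = ≤-trans (≤-reflexive (eq x)) (+-mono-≤ (m≤m⊔n (suc x) 1) (m≤m⊔n (suc x) 1)) }
  where
  both = ∧-split (xor-toggle _ (≢-sym F≢))
  lem : ∀ p u → p xor u ≡ true → not p ≡ u
  lem true  false _ = refl
  lem false true  _ = refl
  eq : ∀ x → suc x + 1 + x ≡ suc x + suc x
  eq = solve-∀
φ-toggle c u ch (suc x) (suc y) F≢ = record
  { odd≡ = trans (cong not (odd-+-suc x y)) (trans (not-involutive _) T.odd≡)
  ; index = T.index ; on = T.on
  ; index≤ = ≤-trans T.index≤ (+-mono-≤ (n≤1+n x) (n≤1+n y))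
  ; index< = m≤n⇒m≤1+n T.index<
  ; sum≤ = ≤-trans (≤-reflexive (eq x y T.index))
             (≤-trans (s≤s (s≤s T.sum≤)) (≤-reflexive (eq′ (x ⊔ suc y)))) }
  where
  module T = Toggle (φ-toggle c u ch x y F≢)
  eq : ∀ x y q → suc x + suc (suc y) + q ≡ suc (suc (x + suc y + q))
  eq = solve-∀
  eq′ : ∀ m → suc (suc (m + m)) ≡ suc m + suc m
  eq′ = solve-∀

Separated : ℕ → (ℕ → Bool) → (ℕ → Bool) → Set
Separated M ch ch′ = ∀ p q → ch p ≡ true → ch′ q ≡ true → p < M → q < M → M ≤ p + q

separated-sym : ∀ {M ch ch′} → Separated M ch ch′ → Separated M ch′ ch
separated-sym {M} sep p q on on′ p< q< = subst (M ≤_) (+-comm q p) (sep q p on′ on q< p<)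

¬true⇒false : ∀ {b} → ¬ (b ≡ true) → b ≡ false
¬true⇒false {true}  b≢ = contradiction refl b≢
¬true⇒false {false} _  = refl

-- The difference ȳ - x is M - (x + y), and the bounds on x + y keep its absolute value at most M -
-- q. Below M - q the toggle at q leaves no toggle to `ch′`.
φ-separated : ∀ {M ch ch′ c u q x y ȳ} → Separated M ch ch′ → ch q ≡ true → q < M →
              y + ȳ ≡ M → q ≤ x + y → x + y + q ≤ M + M → φ c u ch′ x ȳ ≡ c
φ-separated {M} {ch} {ch′} {c} {u} {q} {x} {y} {ȳ} sep on q<M refl q≤ sum≤ =
  φ-near c u ch′ δ x ȳ off
    (+-cancelʳ-≤ (y + q) x (ȳ + δ) (≤-trans (≤-reflexive (eq₁ x y q)) (≤-trans sum≤
      (≤-reflexive (trans (cong (λ z → y + ȳ + z) (sym δ+q)) (eq₂ y ȳ δ q))))))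
    (+-cancelʳ-≤ (y + q) ȳ (x + δ) (≤-trans (≤-reflexive (eq₃ ȳ y q))
      (≤-trans (+-monoʳ-≤ (y + ȳ) q≤) (≤-reflexive
        (trans (cong (_+ (x + y)) (sym δ+q)) (eq₄ δ q x y))))))
  where
  δ = M ∸ q
  δ+q : δ + q ≡ M
  δ+q = m∸n+n≡m (<⇒≤ q<M)
  off : ∀ p → p < δ → ch′ p ≡ false
  off p p<δ = ¬true⇒false λ on′ →
    <⇒≱ (subst (p + q <_) δ+q (+-monoˡ-< q p<δ))
      (subst (M ≤_) (+-comm q p) (sep q p on on′ q<M (≤-trans p<δ (m∸n≤m M q))))
  eq₁ : ∀ x y q → x + (y + q) ≡ x + y + q
  eq₁ = solve-∀
  eq₂ : ∀ y ȳ δ q → y + ȳ + (δ + q) ≡ ȳ + δ + (y + q)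
  eq₂ = solve-∀
  eq₃ : ∀ ȳ y q → ȳ + (y + q) ≡ y + ȳ + q
  eq₃ = solve-∀
  eq₄ : ∀ δ q x y → δ + q + (x + y) ≡ x + δ + (y + q)
  eq₄ = solve-∀

-- These rules hold for (F , Z) = (g , h) with ζ = false, and for (h , g), mirrored by
-- y ↦ M ∸ y, with ζ = odd M; there g and h are twisted by the checkerboard sign.
HorRule : ℕ → Bool → (F Z : ℕ → ℕ → Bool) → Set
HorRule M ζ F Z = ∀ x y → x ≤ M → y < M → F x y ≢ F x (suc y) →
  Z x y ≡ not (ζ xor odd (x + y)) × Z x (suc y) ≡ not (ζ xor odd (x + y))

VerRule : ℕ → Bool → (F Z : ℕ → ℕ → Bool) → Set
VerRule M ζ F Z = ∀ x y → x < M → y ≤ M → F x y ≢ F (suc x) y →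
  Z x y ≡ ζ xor odd (x + y) × Z (suc x) y ≡ ζ xor odd (x + y)

not-xor-flip : ∀ ζ z → z ≡ not (ζ xor not (ζ xor z))
not-xor-flip true  true  = refl
not-xor-flip true  false = refl
not-xor-flip false true  = refl
not-xor-flip false false = refl

-- The parity `not (ζ xor z)` solves the rule for the central value z of the second field: the first
-- field changes only from points of this parity, and near such a change the second field still has
-- its central value.
φ-hor : ∀ {M ζ c z w ch ch′} → Separated M ch ch′ →
        HorRule M ζ (φ c (not (ζ xor z)) ch) (λ x y → φ z w ch′ x (M ∸ y))
φ-hor {M} {ζ} {c} {z} {w} {ch} {ch′} sep x y x≤M y<M F≢ =
    trans (φ-separated {x = x} {y = y} sep T.on q<M (m+[n∸m]≡n (<⇒≤ y<M)) T.index≤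
            (≤-trans (+-monoˡ-≤ T.index (+-monoʳ-≤ x (n≤1+n y))) sum≤)) Z≡
  , trans (φ-separated {x = x} {y = suc y} sep T.on q<M (m+[n∸m]≡n y<M)
            (≤-trans T.index≤ (+-monoʳ-≤ x (n≤1+n y))) sum≤) Z≡
  where
  module T = Toggle (φ-toggle c _ ch x y F≢)
  m≤M : x ⊔ suc y ≤ M
  m≤M = ⊔-lub x≤M y<M
  q<M : T.index < M
  q<M = ≤-trans T.index< m≤M
  sum≤ : x + suc y + T.index ≤ M + M
  sum≤ = ≤-trans T.sum≤ (+-mono-≤ m≤M m≤M)
  Z≡ : z ≡ not (ζ xor odd (x + y))
  Z≡ = trans (not-xor-flip ζ z) (cong (λ p → not (ζ xor p)) (sym T.odd≡))

φ-ver : ∀ {M ζ c z w ch ch′} → Separated M ch ch′ →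
        VerRule M ζ (φ c (not (ζ xor z)) ch) (λ x y → φ z w ch′ x (M ∸ y))
φ-ver {M} {ζ} {c} {z} {w} {ch} {ch′} sep x y x<M y≤M F≢ =
    trans (φ-separated {x = x} {y = y} sep T.on q<M (m+[n∸m]≡n y≤M)
            (subst (T.index ≤_) (+-comm y x) T.index≤)
            (≤-trans (+-monoˡ-≤ T.index (n≤1+n (x + y))) sum≤)) Z≡
  , trans (φ-separated {x = suc x} {y = y} sep T.on q<M (m+[n∸m]≡n y≤M)
            (≤-trans (subst (T.index ≤_) (+-comm y x) T.index≤) (n≤1+n (x + y))) sum≤) Z≡
  where
  u = not (ζ xor z)
  module T = Toggle (φ-toggle c (not u) ch y x λ eq →
    F≢ (trans (φ-transpose c u ch x y) (trans eq (sym (φ-transpose c u ch (suc x) y)))))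
  m≤M : y ⊔ suc x ≤ M
  m≤M = ⊔-lub y≤M x<M
  q<M : T.index < M
  q<M = ≤-trans T.index< m≤M
  sum≤ : suc x + y + T.index ≤ M + M
  sum≤ = ≤-trans (≤-reflexive (cong (_+ T.index) (+-comm (suc x) y)))
           (≤-trans T.sum≤ (+-mono-≤ m≤M m≤M))
  flip : ∀ ζ z → z ≡ ζ xor not (not (ζ xor z))
  flip true  true  = refl
  flip true  false = refl
  flip false true  = refl
  flip false false = refl
  Z≡ : z ≡ ζ xor odd (x + y)
  Z≡ = trans (flip ζ z) (cong (ζ xor_) (trans (sym T.odd≡) (cong odd (+-comm y x))))

-- Fields that obey the local rules come from toggling sequences

Field : Set
Field = ℕ → ℕ → Bool

transpose : Field → Field
transpose F x y = F y x

Diagonal : ℕ → Field → Set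
Diagonal M F = ∀ x y → x < M → y < M → F (suc x) (suc y) ≡ F x y

Antidiagonal : ℕ → Field → Set
Antidiagonal M Z = ∀ x y → x < M → y < M → Z (suc x) y ≡ Z x (suc y)

diagonal-from-edge : ∀ {M F} → Diagonal M F → ∀ x q → x + q ≤ M → F x (x + q) ≡ F 0 q
diagonal-from-edge diag zero    q _  = refl
diagonal-from-edge diag (suc x) q ≤M =
  trans (diag x (x + q) (≤-trans (s≤s (m≤m+n x q)) ≤M) ≤M)
        (diagonal-from-edge diag x q (<⇒≤ ≤M))

antidiagonal-slide : ∀ {M Z} → Antidiagonal M Z → ∀ k x y → k + x ≤ M → k + y ≤ M →
                     Z x (k + y) ≡ Z (k + x) y
antidiagonal-slide anti zero    x y _ _ = refl
antidiagonal-slide {M} {Z} anti (suc k) x y x≤ y≤ =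
  trans (sym (anti x (k + y) (≤-trans (s≤s (m≤n+m x k)) x≤) y≤))
    (trans (antidiagonal-slide {M} {Z} anti k (suc x) y
              (subst (_≤ M) (sym (+-suc k x)) x≤) (<⇒≤ y≤))
           (cong (λ z → Z z y) (+-suc k x)))

antidiagonal-const : ∀ {M Z} → Antidiagonal M Z → ∀ {x y x′ y′} →
                     x ≤ M → y ≤ M → x′ ≤ M → y′ ≤ M → x + y ≡ x′ + y′ → Z x y ≡ Z x′ y′
antidiagonal-const {M} {Z} anti {x} {y} {x′} {y′} x≤ y≤ x′≤ y′≤ eq =
  [ forward y≤ x′≤ eq , (λ x′≤x → sym (forward y′≤ x≤ (sym eq) x′≤x)) ]′ (≤-total x x′)
  where
  shuffle : ∀ k x y′ → k + x + y′ ≡ x + (k + y′)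
  shuffle = solve-∀
  forward : ∀ {x y x′ y′} → y ≤ M → x′ ≤ M → x + y ≡ x′ + y′ → x ≤ x′ → Z x y ≡ Z x′ y′
  forward {x} {y} {x′} {y′} y≤ x′≤ eq x≤x′ with x′ ∸ x | m∸n+n≡m x≤x′
  ... | k | refl with +-cancelˡ-≡ x y (k + y′) (trans eq (shuffle k x y′))
  ... | refl = antidiagonal-slide {Z = Z} anti k x y′ x′≤ y≤

halve : ∀ k → ∃ λ c → k ≡ c + c ⊎ k ≡ suc (c + c)
halve zero = 0 , inj₁ refl
halve (suc k) with halve k
... | c , inj₁ refl = c , inj₂ refl
... | c , inj₂ refl = suc c , inj₁ (cong suc (sym (+-suc c c)))

odd-double : ∀ c q → odd (c + (c + q)) ≡ odd q
odd-double zero    q = refl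
odd-double (suc c) q rewrite +-suc c (c + q) | odd-double c q = not-involutive _

half-≤ : ∀ {m n} → m + m ≤ n + n → m ≤ n
half-≤ {m} {n} 2m≤2n with m ≤? n
... | yes m≤n = m≤n
... | no  m≰n = contradiction 2m≤2n (<⇒≱ (+-mono-< (≰⇒> m≰n) (≰⇒> m≰n)))

record Rules (M : ℕ) (ζ : Bool) (F Z : Field) : Set where
  field
    diag : Diagonal M F
    anti : Antidiagonal M Z
    hor  : HorRule M ζ F Z
    ver  : VerRule M ζ F Z

module _ {M : ℕ} {ζ : Bool} {F Z : Field} (rules : Rules M ζ F Z) where
  open Rules rules

  -- Every step of the staircase starting at (0, q) changes F, because F is constant on diagonals.
  -- The horizontal rule negates where the vertical one does not, and each step flips the parity, so
  -- all prescriptions coincide.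
  hor-spread : ∀ q → q < M → F 0 q ≢ F 0 (suc q) → ∀ x y → x ≤ M → y ≤ M →
               q ≤ x + y → x + y + q ≤ M + M → Z x y ≡ not (ζ xor odd q)
  hor-spread q q<M F≢ x y x≤ y≤ q≤ sum≤ with x + y ∸ q | m∸n+n≡m q≤
  ... | k | k+q with halve k
  -- Here k counts the steps of the staircase from (0, q) to the antidiagonal of (x, y). For k = 0
  -- the first end of the first step is used, otherwise the second end of step number k, which is
  -- vertical for even k and horizontal for odd k.
  ... | zero  , inj₁ refl =
    trans (antidiagonal-const {Z = Z} anti x≤ y≤ z≤n (<⇒≤ q<M) (sym k+q)) (proj₁ (hor 0 q z≤n q<M F≢))
  ... | suc c , inj₁ refl =
    trans (antidiagonal-const {Z = Z} anti x≤ y≤ (≤-trans (m≤m+n (suc c) q) c+q≤) c+q≤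
            (trans (sym k+q) (eq c q)))
    (trans (proj₂ (ver c (suc c + q) (≤-trans (m≤m+n (suc c) q) c+q≤) c+q≤
      λ F≡ → F≢ (trans (sym (diagonal-from-edge {F = F} diag (suc c) q c+q≤))
              (trans (sym F≡) (trans (cong (F c) (sym (+-suc c q)))
              (diagonal-from-edge {F = F} diag c (suc q) (subst (_≤ M) (sym (+-suc c q)) c+q≤)))))))
      (trans (cong (λ z → ζ xor odd z) (+-suc c (c + q)))
        (trans (cong (λ z → ζ xor not z) (odd-double c q)) (xor-not ζ (odd q)))))
    where
    eq : ∀ c q → suc c + suc c + q ≡ suc c + (suc c + q)
    eq = solve-∀
    eq′ : ∀ c q → (suc c + q) + (suc c + q) ≡ suc c + suc c + q + q
    eq′ = solve-∀
    c+q≤ : suc c + q ≤ M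
    c+q≤ = half-≤ (≤-trans (≤-reflexive (trans (eq′ c q) (cong (_+ q) k+q))) sum≤)
    xor-not : ∀ a b → a xor not b ≡ not (a xor b)
    xor-not true  b = refl
    xor-not false b = refl
  ... | c , inj₂ refl =
    trans (antidiagonal-const {Z = Z} anti x≤ y≤ (≤-trans (m≤m+n c q) (<⇒≤ c+q<)) c+q<
            (trans (sym k+q) (eq c q)))
    (trans (proj₂ (hor c (c + q) (≤-trans (m≤m+n c q) (<⇒≤ c+q<)) c+q<
      λ F≡ → F≢ (trans (sym (diagonal-from-edge {F = F} diag c q (<⇒≤ c+q<)))
              (trans F≡ (trans (cong (F c) (sym (+-suc c q)))
              (diagonal-from-edge {F = F} diag c (suc q) (subst (_≤ M) (sym (+-suc c q)) c+q<)))))))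
      (cong (λ z → not (ζ xor z)) (odd-double c q)))
    where
    eq : ∀ c q → suc (c + c) + q ≡ c + suc (c + q)
    eq = solve-∀
    eq′ : ∀ c q → suc ((c + q) + (c + q)) ≡ suc (c + c) + q + q
    eq′ = solve-∀
    c+q< : c + q < M
    c+q< = ≰⇒> λ M≤ → <⇒≱ (≤-trans (≤-reflexive (trans (eq′ c q) (cong (_+ q) k+q))) sum≤)
                           (+-mono-≤ M≤ M≤)

not-xorˡ : ∀ a b → not (a xor b) ≡ not a xor b
not-xorˡ true  b = not-involutive b
not-xorˡ false b = refl

xor-not-not : ∀ a b → a xor b ≡ not (not a xor b)
xor-not-not true  b = refl
xor-not-not false b = sym (not-involutive b)

-- Horizontal and vertical steps prescribe opposite values at the same parity, so exchanging them
-- negates ζ.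
transpose-rules : ∀ {M ζ F Z} → Rules M ζ F Z → Rules M (not ζ) (transpose F) (transpose Z)
transpose-rules {M} {ζ} rules = record
  { diag = λ x y x< y< → diag y x y< x<
  ; anti = λ x y x< y< → sym (anti y x y< x<)
  ; hor = λ x y x≤ y< ne → let z , z′ = ver y x y< x≤ ne in trans z (flip x y) , trans z′ (flip x y)
  ; ver = λ x y x< y≤ ne → let z , z′ = hor y x y≤ x< ne in trans z (flip′ x y) , trans z′ (flip′ x y)
  }
  where
  open Rules rules
  flip : ∀ x y → ζ xor odd (y + x) ≡ not (not ζ xor odd (x + y))
  flip x y = trans (cong (λ s → ζ xor odd s) (+-comm y x)) (xor-not-not ζ _)
  flip′ : ∀ x y → not (ζ xor odd (y + x)) ≡ not ζ xor odd (x + y)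
  flip′ x y = trans (cong (λ s → not (ζ xor odd s)) (+-comm y x)) (not-xorˡ ζ _)

ver-spread : ∀ {M ζ F Z} → Rules M ζ F Z → ∀ q → q < M → F q 0 ≢ F (suc q) 0 →
             ∀ x y → x ≤ M → y ≤ M → q ≤ x + y → x + y + q ≤ M + M → Z x y ≡ ζ xor odd q
ver-spread {M} {ζ} rules q q<M F≢ x y x≤ y≤ q≤ sum≤ = trans
  (hor-spread (transpose-rules rules) q q<M F≢ y x y≤ x≤
    (subst (q ≤_) (+-comm x y) q≤) (subst (λ s → s + q ≤ M + M) (+-comm x y) sum≤))
  (sym (xor-not-not ζ (odd q)))

-- A bit is recorded for the steps at distance q on both sides; the local rules
-- allow F to change at only one of them.
changes : Field → ℕ → Bool
changes F q = (F 0 q xor F 0 (suc q)) ∨ (F q 0 xor F (suc q) 0)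

xor⇒≢ : ∀ {a b} → a xor b ≡ true → a ≢ b
xor⇒≢ {true}  () refl
xor⇒≢ {false} () refl

changes⇒ : ∀ F q → changes F q ≡ true → F 0 q ≢ F 0 (suc q) ⊎ F q 0 ≢ F (suc q) 0
changes⇒ F q on with F 0 q xor F 0 (suc q) in eq
... | true  = inj₁ (xor⇒≢ eq)
... | false = inj₂ (xor⇒≢ on)

xor-recover : ∀ a b → a xor (a xor b) ≡ b
xor-recover true  b = not-involutive b
xor-recover false b = refl

select : ∀ {d d′ z} o ζ → (d ≡ true → z ≡ not (ζ xor o)) → (d′ ≡ true → z ≡ ζ xor o) →
         let t = o xor not (ζ xor z) in (d ∨ d′) ∧ not t ≡ d × (d ∨ d′) ∧ t ≡ d′
select {true}  {true}  o ζ f g = contradiction (trans (sym (g refl)) (f refl)) (not-¬ refl)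
select {true}  {false} o ζ f g rewrite f refl = lemma o ζ
  where
  lemma : ∀ o ζ → let t = o xor not (ζ xor not (ζ xor o)) in not t ≡ true × t ≡ false
  lemma true  true  = refl , refl
  lemma true  false = refl , refl
  lemma false true  = refl , refl
  lemma false false = refl , refl
select {false} {true}  o ζ f g rewrite g refl = lemma o ζ
  where
  lemma : ∀ o ζ → let t = o xor not (ζ xor (ζ xor o)) in not t ≡ false × t ≡ true
  lemma true  true  = refl , refl
  lemma true  false = refl , refl
  lemma false true  = refl , refl
  lemma false false = refl , refl
select {false} {false} o ζ f g = refl , refl

module _ {M : ℕ} {ζ : Bool} {F Z : Field} (rules : Rules M ζ F Z) where
  open Rules rules

  -- The point (0, M) lies on the main antidiagonal, which every staircase meets. The two sides
  -- prescribe opposite values for Z there, so at most one of them changes and `Z 0 M` tells which.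
  step : ∀ {q} → q < M → let t = odd q xor not (ζ xor Z 0 M) in
         changes F q ∧ not t ≡ F 0 q xor F 0 (suc q) × changes F q ∧ t ≡ F q 0 xor F (suc q) 0
  step {q} q<M = select (odd q) ζ
    (λ on → hor-spread rules q q<M (xor⇒≢ on) 0 M z≤n ≤-refl (<⇒≤ q<M) (+-monoʳ-≤ M (<⇒≤ q<M)))
    (λ on → ver-spread rules q q<M (xor⇒≢ on) 0 M z≤n ≤-refl (<⇒≤ q<M) (+-monoʳ-≤ M (<⇒≤ q<M)))

  field≡φ : ∀ x y → x ≤ M → y ≤ M →
            F x y ≡ φ (F 0 0) (not (ζ xor Z 0 M)) (changes F) x y
  field≡φ zero    zero    _ _ = refl
  field≡φ zero    (suc y) _ y< = trans (sym (xor-recover (F 0 y) _))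
    (cong₂ _xor_ (field≡φ zero y z≤n (<⇒≤ y<)) (sym (proj₁ (step y<))))
  field≡φ (suc x) zero    x< _ = trans (sym (xor-recover (F x 0) _))
    (cong₂ _xor_ (field≡φ x zero (<⇒≤ x<) z≤n) (sym (proj₂ (step x<))))
  field≡φ (suc x) (suc y) x< y< =
    trans (diag x y x< y<) (field≡φ x y (<⇒≤ x<) (<⇒≤ y<))

  -- For p + q < M both steps of Z at distance p from the main antidiagonal join antidiagonals that
  -- the staircase at distance q meets, where Z is already fixed to a single value.
  changes-separated : Separated M (changes F) (changes λ x y → Z x (M ∸ y))
  changes-separated q p on on′ q<M p<M = ≮⇒≥ λ q+p<M →
    no-change q+p<M (changes⇒ (λ x y → Z x (M ∸ y)) p on′)
    where
    spread : ∃ λ b → ∀ x y → x ≤ M → y ≤ M → q ≤ x + y → x + y + q ≤ M + M → Z x y ≡ b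
    spread with changes⇒ F q on
    ... | inj₁ F≢ = _ , hor-spread rules q q<M F≢
    ... | inj₂ F≢ = _ , ver-spread rules q q<M F≢
    Z≡ = proj₂ spread
    no-change : q + p < M → Z 0 (M ∸ p) ≢ Z 0 (M ∸ suc p) ⊎ Z p M ≢ Z (suc p) M → ⊥
    no-change q+p<M (inj₁ ne) = ne (trans
      (Z≡ 0 (M ∸ p) z≤n (m∸n≤m M p) (m+n≤o⇒m≤o∸n q (<⇒≤ q+p<M)) (+-mono-≤ (m∸n≤m M p) (<⇒≤ q<M)))
      (sym (Z≡ 0 (M ∸ suc p) z≤n (m∸n≤m M (suc p))
        (m+n≤o⇒m≤o∸n q (subst (_≤ M) (sym (+-suc q p)) q+p<M))
        (+-mono-≤ (m∸n≤m M (suc p)) (<⇒≤ q<M)))))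
    no-change q+p<M (inj₂ ne) = ne (trans
      (Z≡ p M (<⇒≤ p<M) ≤-refl (≤-trans (<⇒≤ q<M) (m≤n+m M p)) (sum p (<⇒≤ q+p<M)))
      (sym (Z≡ (suc p) M p<M ≤-refl (≤-trans (<⇒≤ q<M) (m≤n+m M (suc p)))
        (sum (suc p) (subst (_≤ M) (sym (+-suc q p)) q+p<M)))))
      where
      eq : ∀ p M q → p + M + q ≡ q + p + M
      eq = solve-∀
      sum : ∀ p → q + p ≤ M → p + M + q ≤ M + M
      sum p ≤M = ≤-trans (≤-reflexive (eq p M q)) (+-monoˡ-≤ M ≤M)

∀ᵇ? : {P : Bool → Set} → (∀ b → Dec (P b)) → Dec (∀ b → P b)
∀ᵇ? P? with P? false | P? true
... | yes p | yes q = yes λ { false → p ; true → q }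
... | no ¬p | _     = no λ f → ¬p (f false)
... | _     | no ¬q = no λ f → ¬q (f true)

does⇒ : {P : Set} (P? : Dec P) → does P? ≡ true → P
does⇒ (yes p) _ = p

reflect : ℕ → Field → Field
reflect M F x y = F x (M ∸ y)

∸-suc : ∀ {M y} → y < M → M ∸ y ≡ suc (M ∸ suc y)
∸-suc {suc M} {y} (s≤s y≤M) = +-∸-assoc 1 y≤M

-- Reflection reverses a horizontal step, so the parity is now tested at the other end. This
-- accounts for the negation that `reflect-ver` does not have.
reflect-hor : ∀ {M ζ F Z} → HorRule M ζ F Z →
              HorRule M (not (ζ xor odd M)) (reflect M F) (reflect M Z)
reflect-hor {M} {ζ} {F} {Z} hor x y x≤ y< ne =
    trans (cong (Z x) (∸-suc y<)) (trans (proj₂ rule) sign)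
  , trans (proj₁ rule) sign
  where
  y′ = M ∸ suc y
  rule = hor x y′ x≤ (subst (_≤ M) (∸-suc y<) (m∸n≤m M y))
           λ eq → ne (trans (cong (F x) (∸-suc y<)) (sym eq))
  bool : ∀ ζ x y y′ → not (ζ xor (x xor y′)) ≡ not (not (ζ xor (y′ xor not y)) xor (x xor y))
  bool = toWitness {a? = ∀ᵇ? λ _ → ∀ᵇ? λ _ → ∀ᵇ? λ _ → ∀ᵇ? λ _ → _ ≟ᵇ _} tt
  sign : not (ζ xor odd (x + y′)) ≡ not (not (ζ xor odd M) xor odd (x + y))
  sign rewrite odd-+ x y′ | odd-+ x y =
    trans (bool ζ (odd x) (odd y) (odd y′))
      (cong (λ m → not (not (ζ xor m) xor (odd x xor odd y)))
        (trans (sym (odd-+ y′ (suc y))) (cong odd (m∸n+n≡m y<))))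

reflect-ver : ∀ {M ζ F Z} → VerRule M ζ F Z →
              VerRule M (ζ xor odd M) (reflect M F) (reflect M Z)
reflect-ver {M} {ζ} {F} {Z} ver x y x< y≤ ne = trans (proj₁ rule) sign , trans (proj₂ rule) sign
  where
  y′ = M ∸ y
  rule = ver x y′ x< (m∸n≤m M y) ne
  bool : ∀ ζ x y y′ → ζ xor (x xor y′) ≡ (ζ xor (y′ xor y)) xor (x xor y)
  bool = toWitness {a? = ∀ᵇ? λ _ → ∀ᵇ? λ _ → ∀ᵇ? λ _ → ∀ᵇ? λ _ → _ ≟ᵇ _} tt
  sign : ζ xor odd (x + y′) ≡ (ζ xor odd M) xor odd (x + y)
  sign rewrite odd-+ x y′ | odd-+ x y =
    trans (bool ζ (odd x) (odd y) (odd y′))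
      (cong (λ m → (ζ xor m) xor (odd x xor odd y))
        (trans (sym (odd-+ y′ y)) (cong odd (m∸n+n≡m y≤))))

Agree : ℕ → Field → Field → Set
Agree M F F′ = ∀ x y → x ≤ M → y ≤ M → F x y ≡ F′ x y

reflect-involutive : ∀ M F → Agree M (reflect M (reflect M F)) F
reflect-involutive M F x y _ y≤ = cong (F x) (m∸[m∸n]≡n y≤)

hor-cong : ∀ {M ζ F Z Z′} → Agree M Z Z′ → HorRule M ζ F Z → HorRule M ζ F Z′
hor-cong ag hor x y x≤ y< ne =
    trans (sym (ag x y x≤ (<⇒≤ y<))) (proj₁ (hor x y x≤ y< ne))
  , trans (sym (ag x (suc y) x≤ y<)) (proj₂ (hor x y x≤ y< ne))

ver-cong : ∀ {M ζ F Z Z′} → Agree M Z Z′ → VerRule M ζ F Z → VerRule M ζ F Z′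
ver-cong ag ver x y x< y≤ ne =
    trans (sym (ag x y (<⇒≤ x<) y≤)) (proj₁ (ver x y x< y≤ ne))
  , trans (sym (ag (suc x) y x< y≤)) (proj₂ (ver x y x< y≤ ne))

reflect-diagonal : ∀ {M F} → Antidiagonal M F → Diagonal M (reflect M F)
reflect-diagonal {M} {F} anti x y x< y< = trans
  (anti x (M ∸ suc y) x< (subst (_≤ M) (∸-suc y<) (m∸n≤m M y)))
  (cong (F x) (sym (∸-suc y<)))

reflect-antidiagonal : ∀ {M F} → Diagonal M F → Antidiagonal M (reflect M F)
reflect-antidiagonal {M} {F} diag x y x< y< = trans
  (cong (F (suc x)) (∸-suc y<))
  (diag x (M ∸ suc y) x< (subst (_≤ M) (∸-suc y<) (m∸n≤m M y)))

φ-diagonal : ∀ {M c u ch} → Diagonal M (φ c u ch)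
φ-diagonal x y _ _ = refl

φ-cong : ∀ {M c u ch ch′} → (∀ q → q < M → ch q ≡ ch′ q) → Agree M (φ c u ch) (φ c u ch′)
φ-cong eq zero    zero    _  _  = refl
φ-cong {u = u} eq zero    (suc y) x≤ y< =
  cong₂ (λ f s → f xor (s ∧ not (odd y xor u))) (φ-cong eq zero y x≤ (<⇒≤ y<)) (eq y y<)
φ-cong {u = u} eq (suc x) zero    x< y≤ =
  cong₂ (λ f s → f xor (s ∧ (odd x xor u))) (φ-cong eq x zero (<⇒≤ x<) y≤) (eq x x<)
φ-cong eq (suc x) (suc y) x< y< = φ-cong eq x y (<⇒≤ x<) (<⇒≤ y<)

changes-φ : ∀ c u ch q → changes (φ c u ch) q ≡ ch q
changes-φ c u ch q = bool (φ c u ch 0 q) (φ c u ch q 0) (ch q) (odd q xor u)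
  where
  bool : ∀ a b s t → (a xor (a xor (s ∧ not t))) ∨ (b xor (b xor (s ∧ t))) ≡ s
  bool = toWitness {a? = ∀ᵇ? λ _ → ∀ᵇ? λ _ → ∀ᵇ? λ _ → ∀ᵇ? λ _ → _ ≟ᵇ _} tt

changes-cong : ∀ {M F F′} → Agree M F F′ → ∀ q → q < M → changes F q ≡ changes F′ q
changes-cong ag q q<
  rewrite ag 0 q z≤n (<⇒≤ q<) | ag 0 (suc q) z≤n q< | ag q 0 (<⇒≤ q<) z≤n | ag (suc q) 0 q< z≤n = refl

-- Words that record the toggles

-- α at position p stands for a toggle of h at distance p, and β at position r for a
-- toggle of g at distance q = M − 1 − r, so that p + q ≥ M says r < p.
data Mark : Set where
  none α β : Mark

isα isβ : Mark → Bool
isα α    = true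
isα none = false
isα β    = false
isβ β    = true
isβ none = false
isβ α    = false

at : ∀ {k} → Vec Mark k → ℕ → Mark
at []      _       = none
at (x ∷ w) zero    = x
at (x ∷ w) (suc p) = at w p

-- A word is `early` as long as β may still occur; the first α makes the rest `late`. Since no
-- position may carry both kinds of toggle, three letters suffice.
late early : ∀ k → List (Vec Mark k)
late zero     = [] ∷ []
late (suc k)  = map (none ∷_) (late k) ++ map (α ∷_) (late k)
early zero    = [] ∷ []
early (suc k) = (map (none ∷_) (early k) ++ map (β ∷_) (early k)) ++ map (α ∷_) (late k)

length-map-++ : ∀ {A B : Set} (f g : A → B) xs ys →
                length (map f xs ++ map g ys) ≡ length xs + length ys
length-map-++ f g xs ys =
  trans (length-++ (map f xs)) (cong₂ _+_ (length-map f xs) (length-map g ys))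

length-late : ∀ k → length (late k) ≡ 2 ^ k
length-late zero    = refl
length-late (suc k) = trans (length-map-++ (none ∷_) (α ∷_) (late k) (late k))
  (cong₂ _+_ (length-late k) (trans (length-late k) (sym (+-identityʳ (2 ^ k)))))

-- A first α at position i leaves 2^i choices before it and 2^(k - 1 - i) after it, hence 2^(k - 1)
-- words for each of the k positions; the words without α add 2^k. Doubling avoids the exponent k -
-- 1.
length-early : ∀ k → 2 * length (early k) ≡ (2 + k) * 2 ^ k
length-early zero    = refl
length-early (suc k) = begin
  2 * length (early (suc k))                         ≡⟨ cong (2 *_) split ⟩
  2 * (length (early k) + length (early k) + 2 ^ k)  ≡⟨ eq₁ (length (early k)) (2 ^ k) ⟩
  2 * (2 * length (early k)) + 2 * 2 ^ k             ≡⟨ cong (λ l → 2 * l + 2 * 2 ^ k) (length-early k) ⟩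
  2 * ((2 + k) * 2 ^ k) + 2 * 2 ^ k                  ≡⟨ eq₂ k (2 ^ k) ⟩
  (2 + suc k) * 2 ^ suc k                            ∎
  where
  open ≡-Reasoning
  split : length (early (suc k)) ≡ length (early k) + length (early k) + 2 ^ k
  split = trans (length-++ (map (none ∷_) (early k) ++ map (β ∷_) (early k)))
    (cong₂ _+_ (length-map-++ (none ∷_) (β ∷_) (early k) (early k))
               (trans (length-map (α ∷_) (late k)) (length-late k)))
  eq₁ : ∀ l p → 2 * (l + l + p) ≡ 2 * (2 * l) + 2 * p
  eq₁ = solve-∀
  eq₂ : ∀ k p → 2 * ((2 + k) * p) + 2 * p ≡ (2 + suc k) * (2 * p)
  eq₂ = solve-∀

map-heads-disjoint : ∀ {k x y} (ws vs : List (Vec Mark k)) → x ≢ y →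
                     ∀ {v} → ¬ (v ∈ map (x ∷_) ws × v ∈ map (y ∷_) vs)
map-heads-disjoint {x = x} {y} ws vs x≢y (∈w , ∈v) with ∈-map⁻ (x ∷_) ∈w | ∈-map⁻ (y ∷_) ∈v
... | _ , _ , refl | _ , _ , eq = x≢y (proj₁ (∷-injective eq))

late-unique : ∀ k → Unique (late k)
late-unique zero    = [] ∷ []
late-unique (suc k) = Unique.++⁺
  (Unique.map⁺ (λ eq → proj₂ (∷-injective eq)) (late-unique k))
  (Unique.map⁺ (λ eq → proj₂ (∷-injective eq)) (late-unique k))
  (map-heads-disjoint (late k) (late k) λ ())

early-unique : ∀ k → Unique (early k)
early-unique zero    = [] ∷ []
early-unique (suc k) = Unique.++⁺
  (Unique.++⁺
    (Unique.map⁺ (λ eq → proj₂ (∷-injective eq)) (early-unique k))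
    (Unique.map⁺ (λ eq → proj₂ (∷-injective eq)) (early-unique k))
    (map-heads-disjoint (early k) (early k) λ ()))
  (Unique.map⁺ (λ eq → proj₂ (∷-injective eq)) (late-unique k))
  λ (∈l , ∈r) → [ (λ ∈l → map-heads-disjoint (early k) (late k) (λ ()) (∈l , ∈r))
                , (λ ∈l → map-heads-disjoint (early k) (late k) (λ ()) (∈l , ∈r)) ]′
                (∈-++⁻ (map (none ∷_) (early k)) ∈l)

late-no-β : ∀ {k} {w : Vec Mark k} → w ∈ late k → ∀ p → isβ (at w p) ≡ false
late-no-β {zero} (here refl) p = refl
late-no-β {suc k} w∈ p with ∈-++⁻ (map (none ∷_) (late k)) w∈
late-no-β {suc k} w∈ p | inj₁ w∈′ with ∈-map⁻ (none ∷_) w∈′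
late-no-β {suc k} w∈ zero    | inj₁ w∈′ | _ , v∈ , refl = refl
late-no-β {suc k} w∈ (suc p) | inj₁ w∈′ | _ , v∈ , refl = late-no-β v∈ p
late-no-β {suc k} w∈ p | inj₂ w∈′ with ∈-map⁻ (α ∷_) w∈′
late-no-β {suc k} w∈ zero    | inj₂ w∈′ | _ , v∈ , refl = refl
late-no-β {suc k} w∈ (suc p) | inj₂ w∈′ | _ , v∈ , refl = late-no-β v∈ p

early-ordered : ∀ {k} {w : Vec Mark k} → w ∈ early k →
                ∀ p r → isα (at w p) ≡ true → isβ (at w r) ≡ true → r < p
early-ordered {zero} (here refl) p r () _
early-ordered {suc k} w∈ p r isα isβ with ∈-++⁻ (map (none ∷_) (early k) ++ map (β ∷_) (early k)) w∈
early-ordered {suc k} w∈ p r a b | inj₂ w∈′ with ∈-map⁻ (α ∷_) w∈′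
early-ordered {suc k} w∈ p zero    a () | inj₂ w∈′ | v , v∈ , refl
early-ordered {suc k} w∈ p (suc r) a b | inj₂ w∈′ | v , v∈ , refl =
  contradiction (trans (sym b) (late-no-β v∈ r)) λ ()
early-ordered {suc k} w∈ p r a b | inj₁ w∈′ with ∈-++⁻ (map (none ∷_) (early k)) w∈′
early-ordered {suc k} w∈ p r a b | inj₁ _ | inj₁ w∈″ with ∈-map⁻ (none ∷_) w∈″
early-ordered {suc k} w∈ zero    r       () b | inj₁ _ | inj₁ _ | v , v∈ , refl
early-ordered {suc k} w∈ (suc p) zero    a () | inj₁ _ | inj₁ _ | v , v∈ , refl
early-ordered {suc k} w∈ (suc p) (suc r) a b | inj₁ _ | inj₁ _ | v , v∈ , refl =
  s≤s (early-ordered v∈ p r a b)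
early-ordered {suc k} w∈ p r a b | inj₁ _ | inj₂ w∈″ with ∈-map⁻ (β ∷_) w∈″
early-ordered {suc k} w∈ zero    r       () b | inj₁ _ | inj₂ _ | v , v∈ , refl
early-ordered {suc k} w∈ (suc p) zero    a b | inj₁ _ | inj₂ _ | v , v∈ , refl = s≤s z≤n
early-ordered {suc k} w∈ (suc p) (suc r) a b | inj₁ _ | inj₂ _ | v , v∈ , refl =
  s≤s (early-ordered v∈ p r a b)

-- Where both bits hold, α wins and the β is lost; the strict inequality r < p between toggles
-- excludes this case.
word : ∀ k → (ℕ → Bool) → (ℕ → Bool) → Vec Mark k
word zero    a b = []
word (suc k) a b =
  (if a 0 then α else if b 0 then β else none) ∷ word k (λ p → a (suc p)) (λ p → b (suc p))

word∈late : ∀ k a b → (∀ p → p < k → b p ≡ false) → word k a b ∈ late k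
word∈late zero    a b no-b = here refl
word∈late (suc k) a b no-b rewrite no-b 0 (s≤s z≤n) with a 0
... | true  = ∈-++⁺ʳ (map (none ∷_) (late k)) (∈-map⁺ (α ∷_) (word∈late k _ _ λ p p< → no-b (suc p) (s≤s p<)))
... | false = ∈-++⁺ˡ (∈-map⁺ (none ∷_) (word∈late k _ _ λ p p< → no-b (suc p) (s≤s p<)))

word∈early : ∀ k a b → (∀ p r → p < k → r < k → a p ≡ true → b r ≡ true → r < p) →
             word k a b ∈ early k
word∈early zero    a b ordered = here refl
word∈early (suc k) a b ordered with a 0 in a0
... | true  = ∈-++⁺ʳ (map (none ∷_) (early k) ++ map (β ∷_) (early k))
  (∈-map⁺ (α ∷_) (word∈late k _ _ λ p p< →
    ¬true⇒false λ bp → contradiction (ordered 0 (suc p) (s≤s z≤n) (s≤s p<) a0 bp) λ ()))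
... | false with b 0
...   | true  = ∈-++⁺ˡ (∈-++⁺ʳ (map (none ∷_) (early k)) (∈-map⁺ (β ∷_)
  (word∈early k _ _ λ p r p< r< ap br → s≤s⁻¹ (ordered (suc p) (suc r) (s≤s p<) (s≤s r<) ap br))))
...   | false = ∈-++⁺ˡ (∈-++⁺ˡ (∈-map⁺ (none ∷_)
  (word∈early k _ _ λ p r p< r< ap br → s≤s⁻¹ (ordered (suc p) (suc r) (s≤s p<) (s≤s r<) ap br))))

word-α : ∀ k a b p → p < k → isα (at (word k a b) p) ≡ a p
word-α (suc k) a b zero    _ with a 0 | b 0
... | true  | _     = refl
... | false | true  = refl
... | false | false = refl
word-α (suc k) a b (suc p) p< = word-α k _ _ p (s≤s⁻¹ p<)

word-β : ∀ k a b p → p < k → (∀ p → p < k → a p ≡ true → b p ≡ true → ⊥) →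
         isβ (at (word k a b) p) ≡ b p
word-β (suc k) a b zero    _ disj with a 0 in a0 | b 0 in b0
... | true  | true  = ⊥-elim (disj 0 (s≤s z≤n) a0 b0)
... | true  | false = refl
... | false | true  = refl
... | false | false = refl
word-β (suc k) a b (suc p) p< disj = word-β k _ _ p (s≤s⁻¹ p<) λ p p< → disj (suc p) (s≤s p<)

at-injective : ∀ {k} (v w : Vec Mark k) → (∀ p → p < k → at v p ≡ at w p) → v ≡ w
at-injective []      []      eq = refl
at-injective (x ∷ v) (y ∷ w) eq =
  cong₂ _∷_ (eq 0 (s≤s z≤n)) (at-injective v w λ p p< → eq (suc p) (s≤s p<))

mark-injective : ∀ {x y} → isα x ≡ isα y → isβ x ≡ isβ y → x ≡ y
mark-injective {none} {none} _ _ = refl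
mark-injective {α} {α} _ _ = refl
mark-injective {β} {β} _ _ = refl
mark-injective {none} {α} () _
mark-injective {α} {none} () _
mark-injective {none} {β} _ ()
mark-injective {β} {none} _ ()
mark-injective {α} {β} () _
mark-injective {β} {α} () _

-- Arms as pairs of bits and their local rules

-- The arm of an interior grid point is the half of a grid line through it that
-- runs along the middle of a dimer.  It is coded by two bits: h tells whether it
-- points down or left, and g whether it points down or right.
isUp isDown isLeft isRight : Bool → Bool → Bool
isUp    h g = not h ∧ not g
isDown  h g = h ∧ g
isLeft  h g = h ∧ not g
isRight h g = not h ∧ g

HorFit VerFit : (h g h′ g′ : Bool) → Set
HorFit h g h′ g′ =
  isRight h g ≡ isLeft h′ g′ × isUp h g ∧ isUp h′ g′ ≡ false × isDown h g ∧ isDown h′ g′ ≡ false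
VerFit h g h′ g′ =
  isDown h g ≡ isUp h′ g′ × isLeft h g ∧ isLeft h′ g′ ≡ false × isRight h g ∧ isRight h′ g′ ≡ false

horFit? : ∀ h g h′ g′ → Dec (HorFit h g h′ g′)
horFit? h g h′ g′ = (_ ≟ᵇ _) ×-dec ((_ ≟ᵇ _) ×-dec (_ ≟ᵇ _))

verFit? : ∀ h g h′ g′ → Dec (VerFit h g h′ g′)
verFit? h g h′ g′ = (_ ≟ᵇ _) ×-dec ((_ ≟ᵇ _) ×-dec (_ ≟ᵇ _))

record Aligned (M : ℕ) (h g : Field) : Set where
  field
    diag : Diagonal M g
    anti : Antidiagonal M h
    hor  : ∀ x y → x ≤ M → y < M → HorFit (h x y) (g x y) (h x (suc y)) (g x (suc y))
    ver  : ∀ x y → x < M → y ≤ M → VerFit (h x y) (g x y) (h (suc x) y) (g (suc x) y)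

-- Twisting by the checkerboard sign turns the fitting rules into statements about
-- where h and g may change.
twist : Field → Field
twist F x y = F x y xor odd (x + y)

Toggles : (ζ : Bool) (f f′ z z′ : Bool) → Set
Toggles ζ f f′ z z′ = f ≢ f′ → z ≡ ζ × z′ ≡ ζ

toggles? : ∀ ζ f f′ z z′ → Dec (Toggles ζ f f′ z z′)
toggles? ζ f f′ z z′ = ¬? (f ≟ᵇ f′) →-dec ((z ≟ᵇ ζ) ×-dec (z′ ≟ᵇ ζ))

-- The double negation is kept because `HorRule M true` unfolds to it. The sign at the neighbour is
-- `not κ`, as one step changes the parity.
hor-twist : ∀ κ h g h′ g′ → HorFit h g h′ g′ →
  Toggles (not κ) (g xor κ) (g′ xor not κ) (h xor κ) (h′ xor not κ) ×
  Toggles (not (not κ)) (h xor κ) (h′ xor not κ) (g xor κ) (g′ xor not κ)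
hor-twist = toWitness {a? = ∀ᵇ? λ κ → ∀ᵇ? λ h → ∀ᵇ? λ g → ∀ᵇ? λ h′ → ∀ᵇ? λ g′ →
  horFit? h g h′ g′ →-dec (toggles? _ _ _ _ _ ×-dec toggles? _ _ _ _ _)} tt

ver-twist : ∀ κ h g h′ g′ → VerFit h g h′ g′ →
  Toggles κ (g xor κ) (g′ xor not κ) (h xor κ) (h′ xor not κ) ×
  Toggles κ (h xor κ) (h′ xor not κ) (g xor κ) (g′ xor not κ)
ver-twist = toWitness {a? = ∀ᵇ? λ κ → ∀ᵇ? λ h → ∀ᵇ? λ g → ∀ᵇ? λ h′ → ∀ᵇ? λ g′ →
  verFit? h g h′ g′ →-dec (toggles? _ _ _ _ _ ×-dec toggles? _ _ _ _ _)} tt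

hor-untwist : ∀ κ h g h′ g′ →
  Toggles (not κ) g g′ h h′ × Toggles (not (not κ)) h h′ g g′ →
  HorFit (h xor κ) (g xor κ) (h′ xor not κ) (g′ xor not κ)
hor-untwist = toWitness {a? = ∀ᵇ? λ κ → ∀ᵇ? λ h → ∀ᵇ? λ g → ∀ᵇ? λ h′ → ∀ᵇ? λ g′ →
  (toggles? _ _ _ _ _ ×-dec toggles? _ _ _ _ _) →-dec
  horFit? (h xor κ) (g xor κ) (h′ xor not κ) (g′ xor not κ)} tt

ver-untwist : ∀ κ h g h′ g′ →
  Toggles κ g g′ h h′ × Toggles κ h h′ g g′ →
  VerFit (h xor κ) (g xor κ) (h′ xor not κ) (g′ xor not κ)
ver-untwist = toWitness {a? = ∀ᵇ? λ κ → ∀ᵇ? λ h → ∀ᵇ? λ g → ∀ᵇ? λ h′ → ∀ᵇ? λ g′ →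
  (toggles? _ _ _ _ _ ×-dec toggles? _ _ _ _ _) →-dec
  verFit? (h xor κ) (g xor κ) (h′ xor not κ) (g′ xor not κ)} tt

twist-diagonal : ∀ {M F} → Diagonal M F → Diagonal M (twist F)
twist-diagonal diag x y x< y< =
  cong₂ _xor_ (diag x y x< y<) (trans (cong not (odd-+-suc x y)) (not-involutive _))

twist-antidiagonal : ∀ {M F} → Antidiagonal M F → Antidiagonal M (twist F)
twist-antidiagonal anti x y x< y< =
  cong₂ _xor_ (anti x y x< y<) (cong odd (sym (+-suc x y)))

twist-involutive : ∀ F x y → twist (twist F) x y ≡ F x y
twist-involutive F x y with F x y | odd (x + y)
... | true  | true  = refl
... | true  | false = refl
... | false | true  = refl
... | false | false = refl

-- The rules of H carry `true` and `false` because H is not yet reflected. Only horizontal steps are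
-- reversed by the reflection, and both parameters become `odd M`.
record Twisted (M : ℕ) (H G : Field) : Set where
  field
    diag : Diagonal M G
    anti : Antidiagonal M H
    horG : HorRule M false G H
    horH : HorRule M true H G
    verG : VerRule M false G H
    verH : VerRule M false H G

module _ {M : ℕ} {h g : Field} (aligned : Aligned M h g) where
  open Aligned aligned

  private
    horTwist : ∀ x y → x ≤ M → y < M → let H = twist h ; G = twist g ; κ = odd (x + y) in
      Toggles (not κ) (G x y) (G x (suc y)) (H x y) (H x (suc y)) ×
      Toggles (not (not κ)) (H x y) (H x (suc y)) (G x y) (G x (suc y))
    horTwist x y x≤ y< rewrite odd-+-suc x y =
      hor-twist (odd (x + y)) (h x y) (g x y) (h x (suc y)) (g x (suc y)) (hor x y x≤ y<)

    verTwist : ∀ x y → x < M → y ≤ M → let H = twist h ; G = twist g ; κ = odd (x + y) in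
      Toggles κ (G x y) (G (suc x) y) (H x y) (H (suc x) y) ×
      Toggles κ (H x y) (H (suc x) y) (G x y) (G (suc x) y)
    verTwist x y x< y≤ =
      ver-twist (odd (x + y)) (h x y) (g x y) (h (suc x) y) (g (suc x) y) (ver x y x< y≤)

  aligned⇒twisted : Twisted M (twist h) (twist g)
  aligned⇒twisted = record
    { diag = twist-diagonal {F = g} diag
    ; anti = twist-antidiagonal {F = h} anti
    ; horG = λ x y x≤ y< → proj₁ (horTwist x y x≤ y<)
    ; horH = λ x y x≤ y< → proj₂ (horTwist x y x≤ y<)
    ; verG = λ x y x< y≤ → proj₁ (verTwist x y x< y≤)
    ; verH = λ x y x< y≤ → proj₂ (verTwist x y x< y≤)
    }

twisted⇒aligned : ∀ {M H G} → Twisted M H G → Aligned M (twist H) (twist G)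
twisted⇒aligned {M} {H} {G} twisted = record
  { diag = twist-diagonal {F = G} diag
  ; anti = twist-antidiagonal {F = H} anti
  ; hor = horFit
  ; ver = λ x y x< y≤ → ver-untwist (odd (x + y)) (H x y) (G x y) (H (suc x) y) (G (suc x) y)
              (verG x y x< y≤ , verH x y x< y≤)
  }
  where
  open Twisted twisted
  horFit : ∀ x y → x ≤ M → y < M →
    HorFit (twist H x y) (twist G x y) (twist H x (suc y)) (twist G x (suc y))
  horFit x y x≤ y< rewrite odd-+-suc x y =
    hor-untwist (odd (x + y)) (H x y) (G x y) (H x (suc y)) (G x (suc y))
      (horG x y x≤ y< , horH x y x≤ y<)

-- Codes and the fields that they describe

∸-suc< : ∀ {M q} → q < M → M ∸ suc q < M
∸-suc< {M} {q} q< = subst (_≤ M) (∸-suc q<) (m∸n≤m M q)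

∸-suc-involutive : ∀ {M q} → q < M → M ∸ suc (M ∸ suc q) ≡ q
∸-suc-involutive {M} q< = trans (cong (M ∸_) (sym (∸-suc q<))) (m∸[m∸n]≡n (<⇒≤ q<))

Code : ℕ → Set
Code M = Bool × Bool × Vec Mark M

codes : ∀ M → List (Code M)
codes M = cartesianProduct bools (cartesianProduct bools (early M))
  where bools = false ∷ true ∷ []

hChanges gChanges : ∀ {M} → Vec Mark M → ℕ → Bool
hChanges     w p = isα (at w p)
gChanges {M} w q = isβ (at w (M ∸ suc q))

-- Each central value fixes the toggle parity of the other field: `not (odd M xor γ)` and `not η`
-- are `not (ζ xor z)` for ζ = odd M and ζ = false. The reflection in `codeH` moves a field constant
-- on diagonals to the antidiagonals.
codeH codeG : ∀ {M} → Code M → Field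
codeH {M} (η , γ , w) = reflect M (φ η (not (odd M xor γ)) (hChanges w))
codeG     (η , γ , w) = φ γ (not η) (gChanges w)

length-codes : ∀ M → length (codes M) ≡ (2 + M) * 2 ^ (1 + M)
length-codes M = trans (length-4 (early M))
  (trans (cong (2 *_) (length-early M)) (eq M (2 ^ M)))
  where
  length-4 : ∀ {A : Set} (xs : List A) → length (cartesianProduct (false ∷ true ∷ [])
               (cartesianProduct (false ∷ true ∷ []) xs)) ≡ 2 * (2 * length xs)
  length-4 xs = trans (double (cartesianProduct (false ∷ true ∷ []) xs)) (cong (2 *_) (double xs))
    where
    double : ∀ {A : Set} (xs : List A) → length (cartesianProduct (false ∷ true ∷ []) xs) ≡ 2 * length xs
    double {A} xs = trans (length-++ (map (pair false) xs)) (cong₂ _+_ (length-map (pair false) xs)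
      (trans (length-++ (map (pair true) xs)) (cong (_+ 0) (length-map (pair true) xs))))
      where
      pair : Bool → A → Bool × A
      pair = _,_
  eq : ∀ M p → 2 * ((2 + M) * p) ≡ (2 + M) * (2 * p)
  eq = solve-∀

codes-unique : ∀ M → Unique (codes M)
codes-unique M = Unique.cartesianProduct⁺ bools-unique
                   (Unique.cartesianProduct⁺ bools-unique (early-unique M))
  where
  bools-unique : Unique (false ∷ true ∷ [])
  bools-unique = ((λ ()) ∷ []) ∷ [] ∷ []

changes-sep : ∀ {M} (w : Vec Mark M) → w ∈ early M → Separated M (hChanges w) (gChanges w)
changes-sep {M} w w∈ p q a b p< q< =
  subst (_≤ p + q) (m∸n+n≡m q<)
    (≤-trans (≤-reflexive (+-suc (M ∸ suc q) q)) (+-monoˡ-≤ q (early-ordered w∈ p (M ∸ suc q) a b)))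

code-twisted : ∀ {M} (c : Code M) → c ∈ codes M → Twisted M (codeH c) (codeG c)
code-twisted {M} c@(η , γ , w) c∈ = record
  { diag = φ-diagonal {M}
  ; anti = reflect-antidiagonal {M} φ-diagonal
  ; horG = φ-hor {ζ = false} sepG
  ; verG = φ-ver {ζ = false} sepG
  ; horH = λ x y x≤ y< ne → let z , z′ = horH′ x y x≤ y< ne in trans z (flip x y) , trans z′ (flip x y)
  ; verH = λ x y x< y≤ ne → let z , z′ = verH′ x y x< y≤ ne in trans z (flip′ x y) , trans z′ (flip′ x y)
  }
  where
  w∈ = proj₂ (∈-cartesianProduct⁻ (false ∷ true ∷ []) (early M)
         (proj₂ (∈-cartesianProduct⁻ (false ∷ true ∷ []) _ c∈)))
  sepH = changes-sep w w∈
  sepG : Separated M (gChanges w) (hChanges w)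
  sepG = separated-sym {ch = hChanges w} sepH
  horH′ = hor-cong {ζ = not (odd M xor odd M)} {F = codeH c} {Z′ = codeG c} (reflect-involutive M (codeG c))
            (reflect-hor {ζ = odd M} {Z = reflect M (codeG c)} (φ-hor {ζ = odd M} {η} {γ} {not η} sepH))
  verH′ = ver-cong {ζ = odd M xor odd M} {F = codeH c} {Z′ = codeG c} (reflect-involutive M (codeG c))
            (reflect-ver {ζ = odd M} {Z = reflect M (codeG c)} (φ-ver {ζ = odd M} {η} {γ} {not η} sepH))
  bool : ∀ m k → not (not (m xor m) xor k) ≡ not (not k)
  bool = toWitness {a? = ∀ᵇ? λ _ → ∀ᵇ? λ _ → _ ≟ᵇ _} tt
  bool′ : ∀ m k → (m xor m) xor k ≡ k
  bool′ = toWitness {a? = ∀ᵇ? λ _ → ∀ᵇ? λ _ → _ ≟ᵇ _} tt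
  flip : ∀ x y → not (not (odd M xor odd M) xor odd (x + y)) ≡ not (not (odd (x + y)))
  flip x y = bool (odd M) (odd (x + y))
  flip′ : ∀ x y → (odd M xor odd M) xor odd (x + y) ≡ odd (x + y)
  flip′ x y = bool′ (odd M) (odd (x + y))

code-aligned : ∀ {M} (c : Code M) → c ∈ codes M → Aligned M (twist (codeH c)) (twist (codeG c))
code-aligned c c∈ = twisted⇒aligned (code-twisted c c∈)

module _ {M : ℕ} {H G : Field} (twisted : Twisted M H G) where
  open Twisted twisted

  private
    H* = reflect M H
    G* = reflect M G

    rulesG : Rules M false G H
    rulesG = record { diag = diag ; anti = anti ; hor = horG ; ver = verG }

    rulesH : Rules M (odd M) H* G*
    rulesH = record
      { diag = reflect-diagonal {F = H} anti
      ; anti = reflect-antidiagonal {F = G} diag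
      ; hor = subst (λ ζ → HorRule M ζ H* G*) (not-involutive (odd M)) (reflect-hor {ζ = true} {F = H} {Z = G} horH)
      ; ver = reflect-ver {ζ = false} {F = H} {Z = G} verH
      }

    η = H 0 M
    γ = G 0 0
    a = changes H*
    b = λ r → changes G (M ∸ suc r)

    ordered : ∀ p r → p < M → r < M → a p ≡ true → b r ≡ true → r < p
    ordered p r p< r< ap br = +-cancelʳ-≤ (M ∸ suc r) (suc r) p
      (≤-trans (≤-reflexive (m+[n∸m]≡n r<))
        (subst (M ≤_) (+-comm (M ∸ suc r) p)
          (changes-separated rulesG (M ∸ suc r) p br ap (∸-suc< r<) p<)))

    w = word M a b

  twisted-code : Code M
  twisted-code = η , γ , w

  twisted-code∈ : twisted-code ∈ codes M
  twisted-code∈ = ∈-cartesianProduct⁺ (bool∈ η) (∈-cartesianProduct⁺ (bool∈ γ) (word∈early M a b ordered))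
    where
    bool∈ : ∀ b → b ∈ false ∷ true ∷ []
    bool∈ false = here refl
    bool∈ true  = there (here refl)

  twisted-codeG : Agree M G (codeG twisted-code)
  twisted-codeG x y x≤ y≤ = trans (field≡φ rulesG x y x≤ y≤)
    (φ-cong (λ q q< → trans (cong (changes G) (sym (∸-suc-involutive q<)))
      (sym (word-β M a b (M ∸ suc q) (∸-suc< q<) λ p p< ap bp → <-irrefl refl (ordered p p p< p< ap bp))))
      x y x≤ y≤)

  twisted-codeH : Agree M H (codeH twisted-code)
  twisted-codeH x y x≤ y≤ = trans (cong (H x) (sym (m∸[m∸n]≡n y≤)))
    (trans (field≡φ rulesH x (M ∸ y) x≤ (m∸n≤m M y))
      -- The central value seen by `rulesH` is the reflected G at (0, M), which is G at (0, 0), that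
      -- is γ.
      (trans (cong (λ z → φ η (not (odd M xor z)) a x (M ∸ y)) (cong (G 0) (n∸n≡0 M)))
        (φ-cong {M} (λ q q< → sym (word-α M a b q q<)) x (M ∸ y) x≤ (m∸n≤m M y))))

code-injective : ∀ {M} (c c′ : Code M) → Agree M (codeH c) (codeH c′) → Agree M (codeG c) (codeG c′) →
                 c ≡ c′
code-injective {M} c@(η , γ , w) c′@(η′ , γ′ , w′) agH agG =
  cong₂ _,_ η≡ (cong₂ _,_ (agG 0 0 z≤n z≤n) (at-injective w w′ λ p p< →
    mark-injective (α≡ p p<)
      (subst (λ r → isβ (at w r) ≡ isβ (at w′ r)) (∸-suc-involutive p<) (β≡ (M ∸ suc p) (∸-suc< p<)))))
  where
  η≡ : η ≡ η′
  η≡ = subst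
    (λ z → φ η (not (odd M xor γ)) (hChanges w) 0 z ≡ φ η′ (not (odd M xor γ′)) (hChanges w′) 0 z)
    (n∸n≡0 M) (agH 0 M z≤n ≤-refl)
  ag* : Agree M (φ η (not (odd M xor γ)) (hChanges w)) (φ η′ (not (odd M xor γ′)) (hChanges w′))
  ag* x y x≤ y≤ = subst (λ z → φ η (not (odd M xor γ)) (hChanges w) x z
      ≡ φ η′ (not (odd M xor γ′)) (hChanges w′) x z)
    (m∸[m∸n]≡n y≤) (agH x (M ∸ y) x≤ (m∸n≤m M y))
  α≡ : ∀ p → p < M → hChanges w p ≡ hChanges w′ p
  α≡ p p< = trans (sym (changes-φ η (not (odd M xor γ)) (hChanges w) p))
    (trans (changes-cong ag* p p<) (changes-φ η′ (not (odd M xor γ′)) (hChanges w′) p))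
  β≡ : ∀ q → q < M → gChanges w q ≡ gChanges w′ q
  β≡ q q< = trans (sym (changes-φ γ (not η) (gChanges w) q))
    (trans (changes-cong agG q q<) (changes-φ γ′ (not η′) (gChanges w′) q))

-- Counting dimers by pairs of grid points symmetric about the main antidiagonal

sum< : ℕ → (ℕ → ℕ) → ℕ
sum< zero    f = 0
sum< (suc n) f = f 0 + sum< n (λ i → f (suc i))

sum<-cong : ∀ n {f g} → (∀ i → i < n → f i ≡ g i) → sum< n f ≡ sum< n g
sum<-cong zero    eq = refl
sum<-cong (suc n) eq = cong₂ _+_ (eq 0 (s≤s z≤n)) (sum<-cong n λ i i< → eq (suc i) (s≤s i<))

+-interchange : ∀ a b c d → (a + b) + (c + d) ≡ (a + c) + (b + d)
+-interchange = solve-∀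

sum<-+ : ∀ n f g → sum< n (λ i → f i + g i) ≡ sum< n f + sum< n g
sum<-+ zero    f g = refl
sum<-+ (suc n) f g rewrite sum<-+ n (λ i → f (suc i)) (λ i → g (suc i)) = +-interchange (f 0) (g 0) _ _

sum<-0 : ∀ n → sum< n (λ _ → 0) ≡ 0
sum<-0 zero    = refl
sum<-0 (suc n) = sum<-0 n

sum<-const : ∀ n c → sum< n (λ _ → c) ≡ n * c
sum<-const zero    c = refl
sum<-const (suc n) c = cong (c +_) (sum<-const n c)

sum<-last : ∀ n f → sum< (suc n) f ≡ sum< n f + f n
sum<-last zero    f = +-identityʳ (f 0)
sum<-last (suc n) f = trans (cong (f 0 +_) (sum<-last n (λ i → f (suc i))))
  (sym (+-assoc (f 0) (sum< n (λ i → f (suc i))) (f (suc n))))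

sum<-swap : ∀ m n (f : ℕ → ℕ → ℕ) →
            sum< m (λ i → sum< n (f i)) ≡ sum< n (λ j → sum< m (λ i → f i j))
sum<-swap zero    n f = sym (sum<-0 n)
sum<-swap (suc m) n f = trans (cong (sum< n (f 0) +_) (sum<-swap m n (λ i → f (suc i))))
  (sym (sum<-+ n (f 0) (λ j → sum< m (λ i → f (suc i) j))))

sum<-reverse : ∀ M f → sum< (suc M) f ≡ sum< (suc M) (λ i → f (M ∸ i))
sum<-reverse zero    f = refl
sum<-reverse (suc M) f = begin
  f 0 + sum< (suc M) (λ i → f (suc i))          ≡⟨ cong (f 0 +_) (sum<-reverse M (λ i → f (suc i))) ⟩
  f 0 + sum< (suc M) (λ i → f (suc (M ∸ i)))    ≡⟨ cong (f 0 +_) (sum<-cong (suc M) λ i i≤ → cong f (sym (∸-suc i≤))) ⟩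
  f 0 + sum< (suc M) (λ i → f (suc M ∸ i))      ≡⟨ +-comm (f 0) _ ⟩
  sum< (suc M) (λ i → f (suc M ∸ i)) + f 0      ≡⟨ cong (λ z → sum< (suc M) (λ i → f (suc M ∸ i)) + f z) (sym (n∸n≡0 M)) ⟩
  sum< (suc M) (λ i → f (suc M ∸ i)) + f (M ∸ M) ≡⟨ sym (sum<-last (suc M) (λ i → f (suc M ∸ i))) ⟩
  sum< (suc (suc M)) (λ i → f (suc M ∸ i))      ∎
  where open ≡-Reasoning

sum<-mono : ∀ n {f g} → (∀ i → i < n → f i ≤ g i) → sum< n f ≤ sum< n g
sum<-mono zero    le = z≤n
sum<-mono (suc n) le = +-mono-≤ (le 0 (s≤s z≤n)) (sum<-mono n λ i i< → le (suc i) (s≤s i<))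

+-tight : ∀ {a b c d} → a ≤ b → c ≤ d → a + c ≡ b + d → a ≡ b × c ≡ d
+-tight {a} {b} {c} {d} a≤b c≤d eq =
    ≤-antisym a≤b (+-cancelʳ-≤ d b a (≤-trans (≤-reflexive (sym eq)) (+-monoʳ-≤ a c≤d)))
  , ≤-antisym c≤d (+-cancelˡ-≤ b d c (≤-trans (≤-reflexive (sym eq)) (+-monoˡ-≤ c a≤b)))

sum<-tight : ∀ n {f g} → (∀ i → i < n → f i ≤ g i) → sum< n f ≡ sum< n g → ∀ i → i < n → f i ≡ g i
sum<-tight (suc n) le eq i i< with +-tight (le 0 (s≤s z≤n)) (sum<-mono n λ i i< → le (suc i) (s≤s i<)) eq
sum<-tight (suc n) le eq zero    i< | eq₀ , _ = eq₀
sum<-tight (suc n) le eq (suc i) i< | _ , eqₛ =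
  sum<-tight n (λ i i< → le (suc i) (s≤s i<)) eqₛ i (s≤s⁻¹ i<)

sum² : ℕ → (ℕ → ℕ → ℕ) → ℕ
sum² n f = sum< n (λ i → sum< n (f i))

sum²-cong : ∀ n {f g} → (∀ i j → i < n → j < n → f i j ≡ g i j) → sum² n f ≡ sum² n g
sum²-cong n eq = sum<-cong n λ i i< → sum<-cong n λ j j< → eq i j i< j<

sum²-+ : ∀ n f g → sum² n (λ i j → f i j + g i j) ≡ sum² n f + sum² n g
sum²-+ n f g = trans (sum<-cong n λ i _ → sum<-+ n (f i) (g i)) (sum<-+ n _ _)

sum²-reflect : ∀ M f → sum² (suc M) f ≡ sum² (suc M) (λ a b → f (M ∸ b) (M ∸ a))
sum²-reflect M f = begin
  sum² (suc M) f                                  ≡⟨ sum<-reverse M (λ a → sum< (suc M) (f a)) ⟩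
  sum² (suc M) (λ a b → f (M ∸ a) b)              ≡⟨ sum<-cong (suc M) (λ a _ → sum<-reverse M (f (M ∸ a))) ⟩
  sum² (suc M) (λ a b → f (M ∸ a) (M ∸ b))        ≡⟨ sum<-swap (suc M) (suc M) (λ a b → f (M ∸ a) (M ∸ b)) ⟩
  sum² (suc M) (λ a b → f (M ∸ b) (M ∸ a))        ∎
  where open ≡-Reasoning

sum²-tight : ∀ n {f g} → (∀ i j → i < n → j < n → f i j ≤ g i j) → sum² n f ≡ sum² n g →
             ∀ i j → i < n → j < n → f i j ≡ g i j
sum²-tight n le eq i j i< j< = sum<-tight n (λ j j< → le i j i< j<)
  (sum<-tight n (λ i i< → sum<-mono n λ j j< → le i j i< j<) eq i i<) j j<

_≼_ : ℕ → ℕ → Bool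
zero  ≼ _     = true
suc _ ≼ zero  = false
suc a ≼ suc b = a ≼ b

≼⇒≤ : ∀ a b → a ≼ b ≡ true → a ≤ b
≼⇒≤ zero    b       _ = z≤n
≼⇒≤ (suc a) (suc b) e = s≤s (≼⇒≤ a b e)

≤⇒≼ : ∀ {a b} → a ≤ b → a ≼ b ≡ true
≤⇒≼ z≤n     = refl
≤⇒≼ (s≤s p) = ≤⇒≼ p

true⇔⇒≡ : ∀ {a b} → (a ≡ true → b ≡ true) → (b ≡ true → a ≡ true) → a ≡ b
true⇔⇒≡ {true}  {true}  _ _ = refl
true⇔⇒≡ {false} {false} _ _ = refl
true⇔⇒≡ {true}  {false} f _ with f refl
... | ()
true⇔⇒≡ {false} {true}  _ g with g refl
... | ()

≤∸-swap : ∀ {M a b} → a ≤ M → b ≤ M → a ≤ M ∸ b → b ≤ M ∸ a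
≤∸-swap {M} {a} {b} a≤M b≤M a≤ = m+n≤o⇒m≤o∸n b
  (subst (_≤ M) (+-comm a b) (≤-trans (+-monoˡ-≤ b a≤) (≤-reflexive (m∸n+n≡m b≤M))))

∸≤-swap : ∀ {M a b} → M ∸ b ≤ a → M ∸ a ≤ b
∸≤-swap {M} {a} {b} le = m≤n+o⇒m∸n≤o M a
  (≤-trans (m≤n+m∸n M b) (≤-trans (+-monoʳ-≤ b le) (≤-reflexive (+-comm b a))))

when : Bool → ℕ → ℕ
when true  x = x
when false _ = 0

when-+ : ∀ b x y → when b (x + y) ≡ when b x + when b y
when-+ true  x y = refl
when-+ false x y = refl

-- The threshold c counts the index c both as itself and as the predecessor of c + 1.
sum<-threshold : ∀ M c f → c ≤ M →
  sum< (suc (suc M)) f ≡ sum< (suc M) (λ a → when (a ≼ c) (f a) + when (c ≼ a) (f (suc a)))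
sum<-threshold M       zero    f _ = begin
  f 0 + (f 1 + sum< M (λ i → f (suc (suc i))))  ≡⟨ sym (+-assoc (f 0) (f 1) _) ⟩
  (f 0 + f 1) + sum< M (λ i → f (suc (suc i)))  ∎
  where open ≡-Reasoning
sum<-threshold (suc M) (suc c) f (s≤s c≤M) =
  trans (cong (f 0 +_) (sum<-threshold M c (λ i → f (suc i)) c≤M))
        (cong (_+ sum< (suc M) (λ a → when (a ≼ c) (f (suc a)) + when (c ≼ a) (f (suc (suc a)))))
              (sym (+-identityʳ (f 0))))

module _ (M : ℕ) where

  before after : Field
  before a b = a ≼ (M ∸ b)
  after  a b = (M ∸ b) ≼ a

  before-sym : ∀ {a b} → a ≤ M → b ≤ M → before a b ≡ before b a
  before-sym {a} {b} a≤ b≤ = true⇔⇒≡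
    (λ e → ≤⇒≼ (≤∸-swap a≤ b≤ (≼⇒≤ a (M ∸ b) e)))
    (λ e → ≤⇒≼ (≤∸-swap b≤ a≤ (≼⇒≤ b (M ∸ a) e)))

  after-sym : ∀ a b → after a b ≡ after b a
  after-sym a b = true⇔⇒≡
    (λ e → ≤⇒≼ (∸≤-swap {M} {a} {b} (≼⇒≤ (M ∸ b) a e)))
    (λ e → ≤⇒≼ (∸≤-swap {M} {b} {a} (≼⇒≤ (M ∸ a) b e)))

  after-reflect : ∀ {a} b → a ≤ M → after (M ∸ b) (M ∸ a) ≡ before a b
  after-reflect b a≤ = cong (_≼ (M ∸ b)) (m∸[m∸n]≡n a≤)

  edges : (H V : ℕ → ℕ → ℕ) → ℕ
  edges H V = sum< (suc M) (λ j → sum< (suc (suc M)) (λ i → H i j))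
            + sum< (suc M) (λ i → sum< (suc (suc M)) (V i))

  -- Every edge is counted at its end nearer to the main antidiagonal, and the ends
  -- are grouped in pairs symmetric about that antidiagonal.
  pairArms : (H V : ℕ → ℕ → ℕ) → ℕ → ℕ → ℕ
  pairArms H V a b = (H a b + V a b) + (H (suc (M ∸ b)) (M ∸ a) + V (M ∸ b) (suc (M ∸ a)))

  edges-by-pairs : ∀ H V → edges H V ≡ sum² (suc M) (λ a b → when (before a b) (pairArms H V a b))
  edges-by-pairs H V = begin
    edges H V
      ≡⟨ cong₂ _+_ (trans (sum<-cong (suc M) λ b b< → sum<-threshold M (M ∸ b) (λ i → H i b) (m∸n≤m M b))
                     (sum<-swap (suc M) (suc M) (λ b a → fH a b)))
                   (sum<-cong (suc M) λ a a< → trans (sum<-threshold M (M ∸ a) (V a) (m∸n≤m M a))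
                     (sum<-cong (suc M) λ b b< → cong₂ (λ s t → when s (V a b) + when t (V a (suc b)))
                       (before-sym (s≤s⁻¹ b<) (s≤s⁻¹ a<)) (after-sym b a))) ⟩
    sum² (suc M) fH + sum² (suc M) fV
      ≡⟨ sym (sum²-+ (suc M) fH fV) ⟩
    sum² (suc M) (λ a b → fH a b + fV a b)
      ≡⟨ sum²-cong (suc M) (λ a b _ _ → trans
           (+-interchange (when (before a b) (H a b)) (when (after a b) (H (suc a) b))
                            (when (before a b) (V a b)) (when (after a b) (V a (suc b))))
           (sym (cong₂ _+_ (when-+ (before a b) (H a b) (V a b))
                           (when-+ (after a b) (H (suc a) b) (V a (suc b)))))) ⟩
    sum² (suc M) (λ a b → near a b + far a b)
      ≡⟨ sum²-+ (suc M) near far ⟩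
    sum² (suc M) near + sum² (suc M) far
      ≡⟨ cong (sum² (suc M) near +_) (sum²-reflect M far) ⟩
    sum² (suc M) near + sum² (suc M) (λ a b → far (M ∸ b) (M ∸ a))
      ≡⟨ sym (sum²-+ (suc M) near λ a b → far (M ∸ b) (M ∸ a)) ⟩
    sum² (suc M) (λ a b → near a b + far (M ∸ b) (M ∸ a))
      ≡⟨ sum²-cong (suc M) (λ a b a< _ → trans
           (cong (λ t → near a b + when t (H (suc (M ∸ b)) (M ∸ a) + V (M ∸ b) (suc (M ∸ a))))
             (after-reflect b (s≤s⁻¹ a<)))
           (sym (when-+ (before a b) (H a b + V a b) _))) ⟩
    sum² (suc M) (λ a b → when (before a b) (pairArms H V a b)) ∎
    where
    open ≡-Reasoning
    fH fV near far : ℕ → ℕ → ℕ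
    fH a b = when (before a b) (H a b) + when (after a b) (H (suc a) b)
    fV a b = when (before a b) (V a b) + when (after a b) (V a (suc b))
    near a b = when (before a b) (H a b + V a b)
    far  a b = when (after a b) (H (suc a) b + V a (suc b))

  pairs : ℕ
  pairs = sum² (suc M) (λ a b → when (before a b) 1)

  -- Reflection exchanges `before` and `after`. On each line their joint count is M + 2, by
  -- `sum<-threshold` for the constant function 1; a point of the main antidiagonal is counted by
  -- both.
  pairs+pairs : pairs + pairs ≡ suc M * suc (suc M)
  pairs+pairs = begin
    pairs + pairs
      ≡⟨ cong (pairs +_) (trans (sum²-cong (suc M) λ a b a< _ → cong (λ t → when t 1) (sym (after-reflect b (s≤s⁻¹ a<))))
           (sym (sum²-reflect M λ a b → when (after a b) 1))) ⟩
    pairs + sum² (suc M) (λ a b → when (after a b) 1)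
      ≡⟨ sym (sum²-+ (suc M) (λ a b → when (before a b) 1) (λ a b → when (after a b) 1)) ⟩
    sum² (suc M) (λ a b → when (before a b) 1 + when (after a b) 1)
      ≡⟨ sum<-swap (suc M) (suc M) (λ a b → when (before a b) 1 + when (after a b) 1) ⟩
    sum< (suc M) (λ b → sum< (suc M) (λ a → when (before a b) 1 + when (after a b) 1))
      ≡⟨ sum<-cong (suc M) (λ b _ → sym (sum<-threshold M (M ∸ b) (λ _ → 1) (m∸n≤m M b))) ⟩
    sum< (suc M) (λ b → sum< (suc (suc M)) (λ _ → 1))
      ≡⟨ sum<-const (suc M) _ ⟩
    suc M * sum< (suc (suc M)) (λ _ → 1)
      ≡⟨ cong (suc M *_) (trans (sum<-const (suc (suc M)) 1) (*-identityʳ _)) ⟩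
    suc M * suc (suc M) ∎
    where open ≡-Reasoning

-- Tatami fields with the least possible number of dimers

ind : Bool → ℕ
ind b = when b 1

ind-∨ : ∀ a b → a ∧ b ≡ false → ind a + ind b ≡ ind (a ∨ b)
ind-∨ true  false _ = refl
ind-∨ false b     _ = refl

-- H i j and V i j say whether the horizontal and the vertical dimer with top left
-- cell (i , j) are present.  The grid point in the middle of the four cells (a , b)
-- to (suc a , suc b) then has the arms H a b up, H (suc a) b down, V a b left and
-- V a (suc b) right.
record IsTatamiField (M : ℕ) (H V : Field) : Set where
  field
    hh : ∀ i j → H i j ∧ H i (suc j) ≡ false
    vv : ∀ i j → V i j ∧ V (suc i) j ≡ false
    up-left    : ∀ i j → H i j ∧ V i j ≡ false
    up-right   : ∀ i j → H i j ∧ V i (suc j) ≡ false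
    down-left  : ∀ i j → H (suc i) j ∧ V i j ≡ false
    down-right : ∀ i j → H (suc i) j ∧ V i (suc j) ≡ false
    arm : ∀ a b → a ≤ M → b ≤ M → (H a b ∨ V a b) ∨ (H (suc a) b ∨ V a (suc b)) ≡ true

Arms : (H V h g : Field) → ℕ → ℕ → Set
Arms H V h g a b = isUp (h a b) (g a b) ≡ H a b × isDown (h a b) (g a b) ≡ H (suc a) b ×
                   isLeft (h a b) (g a b) ≡ V a b × isRight (h a b) (g a b) ≡ V a (suc b)

indicate : Field → ℕ → ℕ → ℕ
indicate F i j = ind (F i j)

-- The common offset k shows that a point and its mirror image in the main antidiagonal lie on one
-- diagonal.
pair-offset : ∀ {M a b} → b ≤ M → a ≤ M ∸ b → ∃ λ k → M ∸ b ≡ k + a × M ∸ a ≡ k + b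
pair-offset {M} {a} {b} b≤M a≤ = k , sym (m∸n+n≡m a≤) , (begin
  M ∸ a                    ≡⟨ cong (_∸ a) (sym (m∸n+n≡m b≤M)) ⟩
  (M ∸ b + b) ∸ a          ≡⟨ cong (λ z → (z + b) ∸ a) (sym (m∸n+n≡m a≤)) ⟩
  (k + a + b) ∸ a          ≡⟨ cong (_∸ a) (eq k a b) ⟩
  (k + b + a) ∸ a          ≡⟨ m+n∸n≡m (k + b) a ⟩
  k + b                    ∎)
  where
  open ≡-Reasoning
  k = M ∸ b ∸ a
  eq : ∀ k a b → k + a + b ≡ k + b + a
  eq = solve-∀

arms-determined : ∀ u d l r → u ∧ l ≡ false → u ∧ r ≡ false → d ∧ l ≡ false → d ∧ r ≡ false →
  u ∨ l ≡ not (d ∨ r) → isUp (d ∨ l) (d ∨ r) ≡ u × isDown (d ∨ l) (d ∨ r) ≡ d ×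
                        isLeft (d ∨ l) (d ∨ r) ≡ l × isRight (d ∨ l) (d ∨ r) ≡ r
arms-determined = toWitness {a? = ∀ᵇ? λ u → ∀ᵇ? λ d → ∀ᵇ? λ l → ∀ᵇ? λ r →
  (u ∧ l ≟ᵇ false) →-dec ((u ∧ r ≟ᵇ false) →-dec ((d ∧ l ≟ᵇ false) →-dec ((d ∧ r ≟ᵇ false) →-dec
  ((u ∨ l ≟ᵇ not (d ∨ r)) →-dec ((_ ≟ᵇ _) ×-dec ((_ ≟ᵇ _) ×-dec ((_ ≟ᵇ _) ×-dec (_ ≟ᵇ _))))))))} tt

-- A unit square of grid points whose diagonal ends agree in g cannot have a source
-- or a sink of h on the other diagonal.
square-anti : ∀ g hp hq gq hr gr hs → HorFit hp g hq gq → HorFit hr gr hs g →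
              VerFit hp g hr gr → VerFit hq gq hs g → hr ≡ hq
square-anti = toWitness {a? = ∀ᵇ? λ g → ∀ᵇ? λ hp → ∀ᵇ? λ hq → ∀ᵇ? λ gq → ∀ᵇ? λ hr → ∀ᵇ? λ gr → ∀ᵇ? λ hs →
  horFit? hp g hq gq →-dec (horFit? hr gr hs g →-dec (verFit? hp g hr gr →-dec
  (verFit? hq gq hs g →-dec (hr ≟ᵇ hq))))} tt

module _ {M : ℕ} {H V : Field} (tatami : IsTatamiField M H V) where
  open IsTatamiField tatami

  UL DR : Field
  UL a b = H a b ∨ V a b
  DR a b = H (suc a) b ∨ V a (suc b)

  -- All four dimers involved cover the cell (a + 1, b + 1) between the two points, so at most one
  -- of them is present.
  DR-step : ∀ a b → DR a b ≡ true → UL (suc a) (suc b) ≡ false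
  DR-step a b = bool (H (suc a) b) (V a (suc b)) (H (suc a) (suc b)) (V (suc a) (suc b))
    (hh (suc a) b) (up-right (suc a) b)
    (down-left a (suc b)) (vv a (suc b))
    where
    bool : ∀ d r u l → d ∧ u ≡ false → d ∧ l ≡ false → u ∧ r ≡ false → r ∧ l ≡ false →
           d ∨ r ≡ true → u ∨ l ≡ false
    bool true  r     false false _ _ _ _ _ = refl
    bool false true  false false _ _ _ _ _ = refl

  private
    other : ∀ {a b} → a ∨ b ≡ true → a ≡ false → b ≡ true
    other {false} {true} _ _ = refl

    other′ : ∀ {a b} → a ∨ b ≡ true → b ≡ false → a ≡ true
    other′ {true} {false} _ _ = refl

    false≢true : ∀ {b} → b ≡ false → b ≡ true → ⊥
    false≢true refl ()

  DR-next : ∀ a b → a < M → b < M → DR a b ≡ true → DR (suc a) (suc b) ≡ true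
  DR-next a b a< b< dr = other (arm (suc a) (suc b) a< b<) (DR-step a b dr)

  DR-forward : ∀ k a b → k + a ≤ M → k + b ≤ M → DR a b ≡ true → DR (k + a) (k + b) ≡ true
  DR-forward zero    a b _  _  dr = dr
  DR-forward (suc k) a b a≤ b≤ dr =
    DR-next (k + a) (k + b) a≤ b≤ (DR-forward k a b (<⇒≤ a≤) (<⇒≤ b≤) dr)

  pairArms-or : ∀ a b → pairArms M (indicate H) (indicate V) a b ≡ ind (UL a b) + ind (DR (M ∸ b) (M ∸ a))
  pairArms-or a b = cong₂ _+_ (ind-∨ (H a b) (V a b) (up-left a b))
    (ind-∨ (H (suc (M ∸ b)) (M ∸ a)) (V (M ∸ b) (suc (M ∸ a))) (down-right (M ∸ b) (M ∸ a)))

  -- Without an up or left arm the point has a down or right arm. This recurs at every later point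
  -- of the diagonal, in particular at the mirror point.
  pairArms≥1 : ∀ a b → a ≤ M → b ≤ M → a ≤ M ∸ b → 1 ≤ ind (UL a b) + ind (DR (M ∸ b) (M ∸ a))
  pairArms≥1 a b a≤ b≤ a≤b̄ with UL a b in ul
  ... | true  = s≤s z≤n
  ... | false with pair-offset b≤ a≤b̄
  ...   | k , eq , eq′ rewrite eq | eq′
        | DR-forward k a b (subst (_≤ M) eq (m∸n≤m M b)) (subst (_≤ M) eq′ (m∸n≤m M a))
            (other (arm a b a≤ b≤) ul) = s≤s z≤n

  when-pairArms≥1 : ∀ a b → a < suc M → b < suc M →
    when (before M a b) 1 ≤ when (before M a b) (pairArms M (indicate H) (indicate V) a b)
  when-pairArms≥1 a b a< b< with before M a b in eq
  ... | false = z≤n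
  ... | true  = ≤-trans (pairArms≥1 a b (s≤s⁻¹ a<) (s≤s⁻¹ b<) (≼⇒≤ a (M ∸ b) eq))
                        (≤-reflexive (sym (pairArms-or a b)))

  module _ (extremal : edges M (indicate H) (indicate V) ≡ pairs M) where

    tight : ∀ a b → a ≤ M → b ≤ M → a ≤ M ∸ b → ind (UL a b) + ind (DR (M ∸ b) (M ∸ a)) ≡ 1
    tight a b a≤ b≤ a≤b̄ = trans (sym (pairArms-or a b))
      (subst (λ t → when t (pairArms M (indicate H) (indicate V) a b) ≡ when t 1) (≤⇒≼ a≤b̄) (sym
        (sum²-tight (suc M) when-pairArms≥1
          (trans (sym extremal) (edges-by-pairs M (indicate H) (indicate V))) a b (s≤s a≤) (s≤s b≤))))

    Settled : Bool → ℕ → ℕ → Set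
    Settled g a b = DR a b ≡ g × UL a b ≡ not g

    -- With a total of 1, either the near point has an up or left arm or the mirror point has a down
    -- or right arm, but not both. In the first case a down or right arm at the near point would
    -- travel to the mirror point. In the second, the near point has such an arm, and the copy one
    -- step before the mirror point excludes up and left arms there; for k = 0 the two points
    -- coincide.
    pair-settled : ∀ a b → a ≤ M → b ≤ M → a ≤ M ∸ b → ∃ λ g → Settled g a b × Settled g (M ∸ b) (M ∸ a)
    pair-settled a b a≤ b≤ a≤b̄ with UL a b in ul | DR (M ∸ b) (M ∸ a) in dr | tight a b a≤ b≤ a≤b̄
                                   | pair-offset b≤ a≤b̄
    ... | true  | false | _ | k , eq , eq′ =
      false , ((¬true⇒false λ dr₀ → false≢true dr
                (subst₂ (λ x y → DR x y ≡ true) (sym eq) (sym eq′)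
                  (DR-forward k a b (subst (_≤ M) eq (m∸n≤m M b)) (subst (_≤ M) eq′ (m∸n≤m M a)) dr₀))) , refl)
            , (refl , other′ (arm (M ∸ b) (M ∸ a) (m∸n≤m M b) (m∸n≤m M a)) dr)
    ... | false | true  | _ | zero , eq , eq′ =
      true , (other (arm a b a≤ b≤) ul , refl)
           , (refl , subst₂ (λ x y → UL x y ≡ false) (sym eq) (sym eq′) ul)
    ... | false | true  | _ | suc k , eq , eq′ =
      true , (other (arm a b a≤ b≤) ul , refl)
           , (refl , subst₂ (λ x y → UL x y ≡ false) (sym eq) (sym eq′)
               (DR-step (k + a) (k + b) (DR-forward k a b
                 (<⇒≤ (subst (_≤ M) eq (m∸n≤m M b))) (<⇒≤ (subst (_≤ M) eq′ (m∸n≤m M a)))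
                 (other (arm a b a≤ b≤) ul))))
    ... | true  | true  | () | _
    ... | false | false | () | _

    mirror-settled : ∀ a b → a ≤ M → b ≤ M → ∃ λ g → Settled g a b × Settled g (M ∸ b) (M ∸ a)
    mirror-settled a b a≤ b≤ with ≤-total a (M ∸ b)
    ... | inj₁ a≤b̄ = pair-settled a b a≤ b≤ a≤b̄
    ... | inj₂ b̄≤a with pair-settled (M ∸ b) (M ∸ a) (m∸n≤m M b) (m∸n≤m M a)
                          (subst (M ∸ b ≤_) (sym (m∸[m∸n]≡n a≤)) b̄≤a)
    ...   | g , s , s′ =
      g , subst₂ (Settled g) (m∸[m∸n]≡n a≤) (m∸[m∸n]≡n b≤) s′ , s

    -- The next point lies between (a, b) and its mirror image. `DR` can only switch from false to
    -- true along a diagonal and agrees at these two points, so it is constant between them.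
    upper-diagonal : ∀ a b → a < M ∸ b → b < M → DR (suc a) (suc b) ≡ DR a b
    upper-diagonal a b a<b̄ b<M with pair-settled a b (≤-trans (<⇒≤ a<b̄) (m∸n≤m M b)) (<⇒≤ b<M) (<⇒≤ a<b̄)
                                   | pair-offset (<⇒≤ b<M) (<⇒≤ a<b̄)
    ... | true  , (dr , _) , _ | _ = trans (DR-next a b (≤-trans a<b̄ (m∸n≤m M b)) b<M dr) (sym dr)
    ... | false , _ , _ | zero , eq , _ = contradiction (sym eq) (<⇒≢ a<b̄)
    ... | false , (dr , _) , (dr′ , _) | suc k , eq , eq′ = trans
      (¬true⇒false λ dr₁ → false≢true dr′ (subst₂ (λ x y → DR x y ≡ true) (sym eqₛ) (sym eqₛ′)
        (DR-forward k (suc a) (suc b) (subst (_≤ M) eqₛ (m∸n≤m M b)) (subst (_≤ M) eqₛ′ (m∸n≤m M a)) dr₁)))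
      (sym dr)
      where
      eqₛ = trans eq (sym (+-suc k a))
      eqₛ′ = trans eq′ (sym (+-suc k b))

    mirror : ∀ a b → a ≤ M → b ≤ M → DR a b ≡ DR (M ∸ b) (M ∸ a)
    mirror a b a≤ b≤ with mirror-settled a b a≤ b≤
    ... | g , (dr , _) , (dr′ , _) = trans dr (sym dr′)

    DR-diagonal : Diagonal M DR
    DR-diagonal a b a<M b<M with a <? M ∸ b
    ... | yes a<b̄ = upper-diagonal a b a<b̄ b<M
    -- On or beyond the main antidiagonal both points are mirrored to the near side, where their
    -- order on the diagonal is reversed.
    ... | no  a≮b̄ = begin
      DR (suc a) (suc b)                        ≡⟨ mirror (suc a) (suc b) a<M b<M ⟩
      DR (M ∸ suc b) (M ∸ suc a)                ≡⟨ sym (upper-diagonal (M ∸ suc b) (M ∸ suc a) (≤-trans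
        (≤-reflexive (sym (∸-suc b<M))) (≤-trans (≮⇒≥ a≮b̄) (<⇒≤ (≤-reflexive (sym (m∸[m∸n]≡n a<M))))))
        (∸-suc< a<M)) ⟩
      DR (suc (M ∸ suc b)) (suc (M ∸ suc a))    ≡⟨ cong₂ DR (sym (∸-suc b<M)) (sym (∸-suc a<M)) ⟩
      DR (M ∸ b) (M ∸ a)                        ≡⟨ sym (mirror a b (<⇒≤ a<M) (<⇒≤ b<M)) ⟩
      DR a b                                    ∎
      where open ≡-Reasoning

    DL : Field
    DL a b = H (suc a) b ∨ V a b

    arms : ∀ a b → a ≤ M → b ≤ M → Arms H V DL DR a b
    arms a b a≤ b≤ = arms-determined (H a b) (H (suc a) b) (V a b) (V a (suc b))
      (up-left a b) (up-right a b) (down-left a b) (down-right a b) UL≡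
      where
      UL≡ : UL a b ≡ not (DR a b)
      UL≡ with mirror-settled a b a≤ b≤
      ... | g , (dr , ul) , _ = trans ul (cong not (sym dr))

    tatami-aligned : Aligned M DL DR
    tatami-aligned = record { diag = DR-diagonal ; anti = anti ; hor = hor ; ver = ver }
      where
      hor : ∀ x y → x ≤ M → y < M → HorFit (DL x y) (DR x y) (DL x (suc y)) (DR x (suc y))
      hor x y x≤ y< with arms x y x≤ (<⇒≤ y<) | arms x (suc y) x≤ y<
      ... | u , d , l , r | u′ , d′ , l′ , r′ =
        trans r (sym l′) , trans (cong₂ _∧_ u u′) (hh x y) , trans (cong₂ _∧_ d d′) (hh (suc x) y)
      ver : ∀ x y → x < M → y ≤ M → VerFit (DL x y) (DR x y) (DL (suc x) y) (DR (suc x) y)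
      ver x y x< y≤ with arms x y (<⇒≤ x<) y≤ | arms (suc x) y x< y≤
      ... | u , d , l , r | u′ , d′ , l′ , r′ =
        trans d (sym u′) , trans (cong₂ _∧_ l l′) (vv x y) , trans (cong₂ _∧_ r r′) (vv x (suc y))
      anti : Antidiagonal M DL
      anti x y x< y< = square-anti (DR x y) (DL x y) (DL x (suc y)) (DR x (suc y))
          (DL (suc x) y) (DR (suc x) y) (DL (suc x) (suc y))
          (hor x y (<⇒≤ x<) y<)
          (subst (HorFit (DL (suc x) y) (DR (suc x) y) (DL (suc x) (suc y))) (DR-diagonal x y x< y<) (hor (suc x) y x< y<))
          (ver x y x< (<⇒≤ y<))
          (subst (VerFit (DL x (suc y)) (DR x (suc y)) (DL (suc x) (suc y))) (DR-diagonal x y x< y<) (ver x (suc y) x< y<))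

diagonal-forward : ∀ {M F} → Diagonal M F → ∀ k a b → k + a ≤ M → k + b ≤ M → F (k + a) (k + b) ≡ F a b
diagonal-forward diag zero    a b _  _  = refl
diagonal-forward diag (suc k) a b a≤ b≤ =
  trans (diag (k + a) (k + b) a≤ b≤) (diagonal-forward diag k a b (<⇒≤ a≤) (<⇒≤ b≤))

module _ {M : ℕ} {H V g : Field} (diag : Diagonal M g)
         (UL≡ : ∀ a b → a ≤ M → b ≤ M → ind (H a b) + ind (V a b) ≡ ind (not (g a b)))
         (DR≡ : ∀ a b → a ≤ M → b ≤ M → ind (H (suc a) b) + ind (V a (suc b)) ≡ ind (g a b)) where

  -- Both points of a pair lie on one diagonal and share the bit g. The near one contributes `not g`
  -- and the mirror one g, so each pair accounts for exactly one dimer.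
  aligned-extremal : edges M (indicate H) (indicate V) ≡ pairs M
  aligned-extremal = trans (edges-by-pairs M (indicate H) (indicate V))
    (sum²-cong (suc M) λ a b a< b< → pair a b (s≤s⁻¹ a<) (s≤s⁻¹ b<))
    where
    ind-not : ∀ b → ind (not b) + ind b ≡ 1
    ind-not true  = refl
    ind-not false = refl
    pair : ∀ a b → a ≤ M → b ≤ M →
      when (before M a b) (pairArms M (indicate H) (indicate V) a b) ≡ when (before M a b) 1
    pair a b a≤ b≤ with before M a b in eq
    ... | false = refl
    ... | true with pair-offset b≤ (≼⇒≤ a (M ∸ b) eq)
    ...   | k , eqa , eqb = trans
      (cong₂ _+_ (UL≡ a b a≤ b≤) (trans (DR≡ (M ∸ b) (M ∸ a) (m∸n≤m M b) (m∸n≤m M a)) (cong ind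
        (trans (cong₂ g eqa eqb) (diagonal-forward {F = g} diag k a b
          (subst (_≤ M) eqa (m∸n≤m M b)) (subst (_≤ M) eqb (m∸n≤m M a)))))))
      (ind-not (g a b))

-- Subsets of a list and sums over cells

module _ {A : Set} where

  Unique-⊆⇒length≤ : ∀ {xs ys : List A} → Unique xs → (∀ {x} → x ∈ xs → x ∈ ys) → length xs ≤ length ys
  Unique-⊆⇒length≤ {[]}     _          sub = z≤n
  Unique-⊆⇒length≤ {x ∷ xs} (x∉ ∷ uniq) sub with ∈-∃++ (sub (here refl))
  ... | as , bs , refl = subst (suc (length xs) ≤_)
    (sym (trans (length-++ as) (trans (+-suc (length as) (length bs)) (cong suc (sym (length-++ as))))))
    (s≤s (Unique-⊆⇒length≤ uniq λ y∈ → skip y∈ (∈-++⁻ as (sub (there y∈)))))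
    where
    skip : ∀ {y} → y ∈ xs → y ∈ as ⊎ y ∈ x ∷ bs → y ∈ as ++ bs
    skip y∈ (inj₁ y∈as)         = ∈-++⁺ˡ y∈as
    skip y∈ (inj₂ (here y≡x))   = contradiction (sym y≡x) (All.lookup x∉ y∈)
    skip y∈ (inj₂ (there y∈bs)) = ∈-++⁺ʳ as y∈bs

  Unique-≋⇒length≡ : ∀ {xs ys : List A} → Unique xs → Unique ys →
    (∀ {x} → x ∈ xs → x ∈ ys) → (∀ {x} → x ∈ ys → x ∈ xs) → length xs ≡ length ys
  Unique-≋⇒length≡ u v sub sup = ≤-antisym (Unique-⊆⇒length≤ u sub) (Unique-⊆⇒length≤ v sup)

  subsets-⊆ : ∀ {xs ts : List A} → ts ∈ subsets xs → ∀ {t} → t ∈ ts → t ∈ xs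
  subsets-⊆ {[]}     (here refl) ()
  subsets-⊆ {x ∷ xs} ts∈ t∈ with ∈-++⁻ (map (x ∷_) (subsets xs)) ts∈
  ... | inj₂ ts∈′ = there (subsets-⊆ ts∈′ t∈)
  ... | inj₁ ts∈′ with ∈-map⁻ (x ∷_) ts∈′
  subsets-⊆ {x ∷ xs} ts∈ (here eq)  | inj₁ _ | us , us∈ , refl = here eq
  subsets-⊆ {x ∷ xs} ts∈ (there t∈) | inj₁ _ | us , us∈ , refl = there (subsets-⊆ us∈ t∈)

  subsets-unique : ∀ {xs : List A} → Unique xs → Unique (subsets xs)
  subsets-unique {[]}     _           = [] ∷ []
  subsets-unique {x ∷ xs} (x∉ ∷ uniq) = Unique.++⁺
    (Unique.map⁺ (λ { refl → refl }) (subsets-unique uniq)) (subsets-unique uniq)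
    λ (∈ˡ , ∈ʳ) → disjoint ∈ˡ ∈ʳ
    where
    disjoint : ∀ {ts} → ts ∈ map (x ∷_) (subsets xs) → ts ∈ subsets xs → ⊥
    disjoint ∈ˡ ∈ʳ with ∈-map⁻ (x ∷_) ∈ˡ
    ... | _ , _ , refl = All.lookup x∉ (subsets-⊆ ∈ʳ (here refl)) refl

  module _ {P : A → Set} (P? : Decidable P) where

    filter∈subsets : ∀ xs → filter P? xs ∈ subsets xs
    filter∈subsets []       = here refl
    filter∈subsets (x ∷ xs) with P? x
    ... | yes _ = ∈-++⁺ˡ (∈-map⁺ (x ∷_) (filter∈subsets xs))
    ... | no  _ = ∈-++⁺ʳ (map (x ∷_) (subsets xs)) (filter∈subsets xs)

    -- Members of `subsets xs` keep the order of `xs`, so membership alone determines them as lists.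
    -- This allows a tiling to be handled as a Boolean function on tiles.
    subset≡filter : ∀ {xs ts} → Unique xs → ts ∈ subsets xs →
      (∀ {t} → t ∈ xs → t ∈ ts → P t) → (∀ {t} → t ∈ xs → P t → t ∈ ts) → ts ≡ filter P? xs
    subset≡filter {[]}     _           (here refl) _ _ = refl
    subset≡filter {x ∷ xs} (x∉ ∷ uniq) ts∈ sound complete with ∈-++⁻ (map (x ∷_) (subsets xs)) ts∈
    ... | inj₂ ts∈′ = trans
      (subset≡filter uniq ts∈′ (λ t∈ → sound (there t∈)) (λ t∈ → complete (there t∈)))
      (sym (filter-reject P? λ px →
        All.lookup x∉ (subsets-⊆ ts∈′ (complete (here refl) px)) refl))
    ... | inj₁ ts∈′ with ∈-map⁻ (x ∷_) ts∈′
    ... | us , us∈ , refl = trans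
      (cong (x ∷_) (subset≡filter uniq us∈ (λ t∈ t∈us → sound (there t∈) (there t∈us))
        λ t∈ pt → tail t∈ (complete (there t∈) pt)))
      (sym (filter-accept P? (sound (here refl) (here refl))))
      where
      tail : ∀ {t} → t ∈ xs → t ∈ x ∷ us → t ∈ us
      tail t∈ (here refl)  = contradiction refl (All.lookup x∉ t∈)
      tail t∈ (there t∈us) = t∈us

    count-∷ : ∀ x xs → count P? (x ∷ xs) ≡ ind (does (P? x)) + count P? xs
    count-∷ x xs with P? x
    ... | yes _ = refl
    ... | no  _ = refl

    count-++ : ∀ xs ys → count P? (xs ++ ys) ≡ count P? xs + count P? ys
    count-++ xs ys = trans (cong length (filter-++ P? xs ys)) (length-++ (filter P? xs))

  Unique-map : ∀ {B : Set} (f : A → B) {xs} → Unique xs →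
    (∀ {x y} → x ∈ xs → y ∈ xs → f x ≡ f y → x ≡ y) → Unique (map f xs)
  Unique-map f {[]}     _           _   = []
  Unique-map f {x ∷ xs} (x∉ ∷ uniq) inj =
    All.map⁺ (All.tabulate λ y∈ eq → All.lookup x∉ y∈ (inj (here refl) (there y∈) eq)) ∷
    Unique-map f uniq λ x∈ y∈ → inj (there x∈) (there y∈)

count-subsets : ∀ {A C : Set} {P : List A → Set} (P? : Decidable P) {xs : List A} {cs : List C}
  (enc : C → List A) → Unique xs → Unique cs →
  (∀ {c} → c ∈ cs → enc c ∈ subsets xs × P (enc c)) →
  (∀ {ts} → ts ∈ subsets xs → P ts → ∃ λ c → c ∈ cs × ts ≡ enc c) →
  (∀ {c c′} → c ∈ cs → c′ ∈ cs → enc c ≡ enc c′ → c ≡ c′) →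
  count P? (subsets xs) ≡ length cs
count-subsets P? {xs} {cs} enc uxs ucs valid surj inj = trans
  (Unique-≋⇒length≡ (Unique.filter⁺ P? (subsets-unique uxs)) (Unique-map enc ucs inj) to from)
  (length-map enc cs)
  where
  to : ∀ {ts} → ts ∈ filter P? (subsets xs) → ts ∈ map enc cs
  to ts∈ with ∈-filter⁻ P? ts∈
  ... | ts∈′ , pts with surj ts∈′ pts
  ...   | c , c∈ , refl = ∈-map⁺ enc c∈
  from : ∀ {ts} → ts ∈ map enc cs → ts ∈ filter P? (subsets xs)
  from ts∈ with ∈-map⁻ enc ts∈
  ... | c , c∈ , refl = ∈-filter⁺ P? (proj₁ (valid c∈)) (proj₂ (valid c∈))

does-≟true : ∀ b → does (b ≟ᵇ true) ≡ b
does-≟true true  = refl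
does-≟true false = refl

isTrue? : ∀ {A : Set} (f : A → Bool) → Decidable (λ x → f x ≡ true)
isTrue? f x = f x ≟ᵇ true

count-map-applyUpTo : ∀ {A : Set} (f : A → Bool) (h : ℕ → A) n (g : ℕ → ℕ) →
  count (isTrue? f) (map h (applyUpTo g n)) ≡ sum< n (λ i → ind (f (h (g i))))
count-map-applyUpTo f h zero    g = refl
count-map-applyUpTo f h (suc n) g = trans (count-∷ (isTrue? f) (h (g 0)) _)
  (cong₂ _+_ (cong ind (does-≟true (f (h (g 0))))) (count-map-applyUpTo f h n (λ i → g (suc i))))

count-cells : ∀ (F : ℕ × ℕ → Bool) n →
  count (isTrue? F) (cartesianProduct (upTo n) (upTo n)) ≡ sum² n (λ i j → ind (F (i , j)))
count-cells F n = rows n (λ i → i)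
  where
  rows : ∀ m (g : ℕ → ℕ) → count (isTrue? F) (cartesianProduct (applyUpTo g m) (upTo n)) ≡
                           sum< m (λ i → sum< n (λ j → ind (F (g i , j))))
  rows zero    g = refl
  rows (suc m) g = trans (count-++ (isTrue? F) (map (g 0 ,_) (upTo n)) _)
    (cong₂ _+_ (count-map-applyUpTo F (g 0 ,_) n (λ j → j)) (rows m (λ i → g (suc i))))

shiftRight shiftDown : Field → Field
shiftRight F i       zero    = false
shiftRight F i       (suc j) = F i j
shiftDown  F zero    j       = false
shiftDown  F (suc i) j       = F i j

cellSum : (m H V : Field) → ℕ → ℕ → ℕ
cellSum m H V i j =
  ind (m i j) + ((ind (H i j) + ind (shiftRight H i j)) + (ind (V i j) + ind (shiftDown V i j)))

-- A dimer is counted once in each of its two cells, as itself in the first and through a shifted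
-- field in the second. Since the last column of H and the last row of V are empty, both counts give
-- the same number of edges.
area : ∀ M m H V → (∀ i → H i (suc M) ≡ false) → (∀ j → V (suc M) j ≡ false) →
  (∀ i j → i < suc (suc M) → j < suc (suc M) → cellSum m H V i j ≡ 1) →
  suc (suc M) * suc (suc M) ≡
  sum² (suc (suc M)) (indicate m) + (edges M (indicate H) (indicate V) + edges M (indicate H) (indicate V))
area M m H V Hlast Vlast cell = begin
  n * n
    ≡⟨ cong (n *_) (sym (trans (sum<-const n 1) (*-identityʳ n))) ⟩
  n * sum< n (λ _ → 1)
    ≡⟨ sym (sum<-const n (sum< n λ _ → 1)) ⟩
  sum² n (λ _ _ → 1)
    ≡⟨ sym (sum²-cong n cell) ⟩
  sum² n (cellSum m H V)
    ≡⟨ trans (sum²-+ n (indicate m) (λ i j → hs i j + vs i j)) (cong (sum² n (indicate m) +_) (trans (sum²-+ n hs vs)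
         (cong₂ _+_ (sum²-+ n (indicate H) (indicate (shiftRight H)))
                    (sum²-+ n (indicate V) (indicate (shiftDown V)))))) ⟩
  sum² n (indicate m) + ((sum² n (indicate H) + sum² n (indicate (shiftRight H))) +
                         (sum² n (indicate V) + sum² n (indicate (shiftDown V))))
    ≡⟨ cong (sum² n (indicate m) +_) (trans
         (cong₂ _+_ (cong₂ _+_ H-sum (sum<-swap n N λ i j → indicate H i j))
                    (cong₂ _+_ V-sum V-shifted))
         (+-interchange EH EH EV EV)) ⟩
  sum² n (indicate m) + ((EH + EV) + (EH + EV)) ∎
  where
  open ≡-Reasoning
  N = suc M
  n = suc N
  hs vs : ℕ → ℕ → ℕ
  hs i j = indicate H i j + indicate (shiftRight H) i j
  vs i j = indicate V i j + indicate (shiftDown V) i j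
  EH = sum< N (λ j → sum< n (λ i → indicate H i j))
  EV = sum< N (λ i → sum< n (indicate V i))
  H-sum : sum² n (indicate H) ≡ EH
  H-sum = trans (sum<-cong n λ i _ → trans (sum<-last N (indicate H i))
      (trans (cong (λ b → sum< N (indicate H i) + ind b) (Hlast i)) (+-identityʳ _)))
    (sum<-swap n N (indicate H))
  V-sum : sum² n (indicate V) ≡ EV
  V-sum = trans (sum<-last N (λ i → sum< n (indicate V i)))
    (trans (cong (EV +_) (trans (sum<-cong n λ j _ → cong ind (Vlast j)) (sum<-0 n))) (+-identityʳ EV))
  V-shifted : sum² n (indicate (shiftDown V)) ≡ EV
  V-shifted = cong (_+ EV) (sum<-0 n)

-- Tile sets

placements-unique : ∀ r c → Unique (placements r c)
placements-unique r c = Unique.filter⁺ (fits? r c)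
  (Unique.cartesianProductWith⁺ _ (λ { refl → refl , refl })
    (Unique.cartesianProduct⁺ (Unique.upTo⁺ r) (Unique.upTo⁺ c)) shapes-unique)
  where
  shapes-unique : Unique shapes
  shapes-unique = ((λ ()) ∷ (λ ()) ∷ []) ∷ ((λ ()) ∷ []) ∷ [] ∷ []

∈-shapes : ∀ s → s ∈ shapes
∈-shapes monomer         = here refl
∈-shapes horizontalDimer = there (here refl)
∈-shapes verticalDimer   = there (there (here refl))

top<bottom : ∀ t → top t < bottom t
top<bottom (tile i j monomer)         = m<m+n i (s≤s z≤n)
top<bottom (tile i j horizontalDimer) = m<m+n i (s≤s z≤n)
top<bottom (tile i j verticalDimer)   = m<m+n i (s≤s z≤n)

left<right : ∀ t → left t < right t
left<right (tile i j monomer)         = m<m+n j (s≤s z≤n)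
left<right (tile i j horizontalDimer) = m<m+n j (s≤s z≤n)
left<right (tile i j verticalDimer)   = m<m+n j (s≤s z≤n)

∈-placements⁺ : ∀ {r c t} → Fits r c t → t ∈ placements r c
∈-placements⁺ {r} {c} {t} fits@(b≤ , r≤) = ∈-filter⁺ (fits? r c)
  (∈-cartesianProductWith⁺ _ (∈-cartesianProduct⁺ (∈-upTo⁺ (≤-trans (top<bottom t) b≤))
                                                   (∈-upTo⁺ (≤-trans (left<right t) r≤)))
    (∈-shapes (shape t))) fits

∈-placements⁻ : ∀ {r c t} → t ∈ placements r c → Fits r c t
∈-placements⁻ {r} {c} t∈ = proj₂ (∈-filter⁻ (fits? r c)
  {xs = cartesianProductWith (λ (i , j) s → tile i j s) (cells r c) shapes} t∈)

∈-cells : ∀ {r c i j} → i < r → j < c → (i , j) ∈ cells r c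
∈-cells i< j< = ∈-cartesianProduct⁺ (∈-upTo⁺ i<) (∈-upTo⁺ j<)

∈-cells⁻ : ∀ {r c i j} → (i , j) ∈ cells r c → i < r × j < c
∈-cells⁻ {r} {c} ij∈ = let i∈ , j∈ = ∈-cartesianProduct⁻ (upTo r) (upTo c) ij∈ in ∈-upTo⁻ i∈ , ∈-upTo⁻ j∈

leftCandidates upCandidates candidates : ℕ → ℕ → List Tile
leftCandidates i zero    = []
leftCandidates i (suc j) = tile i j horizontalDimer ∷ []
upCandidates zero    j = []
upCandidates (suc i) j = tile i j verticalDimer ∷ []
candidates i j =
  tile i j monomer ∷ tile i j horizontalDimer ∷ (leftCandidates i j ++ tile i j verticalDimer ∷ upCandidates i j)

candidates-unique : ∀ i j → Unique (candidates i j)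
candidates-unique zero zero =
  ((λ ()) ∷ (λ ()) ∷ []) ∷ ((λ ()) ∷ []) ∷ [] ∷ []
candidates-unique zero (suc j) =
  ((λ ()) ∷ (λ ()) ∷ (λ ()) ∷ []) ∷ ((λ ()) ∷ (λ ()) ∷ []) ∷ ((λ ()) ∷ []) ∷ [] ∷ []
candidates-unique (suc i) zero =
  ((λ ()) ∷ (λ ()) ∷ (λ ()) ∷ []) ∷ ((λ ()) ∷ (λ ()) ∷ []) ∷ ((λ ()) ∷ []) ∷ [] ∷ []
candidates-unique (suc i) (suc j) =
  ((λ ()) ∷ (λ ()) ∷ (λ ()) ∷ (λ ()) ∷ []) ∷ ((λ ()) ∷ (λ ()) ∷ (λ ()) ∷ []) ∷
  ((λ ()) ∷ (λ ()) ∷ []) ∷ ((λ ()) ∷ []) ∷ [] ∷ []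

i<i+1 : ∀ i → i < i + 1
i<i+1 i = m<m+n i (s≤s z≤n)

i<i+2 : ∀ i → i < i + 2
i<i+2 i = m<m+n i (s≤s z≤n)

1+i<i+2 : ∀ i → suc i < i + 2
1+i<i+2 i = ≤-reflexive (+-comm 2 i)

covers-one : ∀ {l i} → l ≤ i → i < l + 1 → l ≡ i
covers-one {l} {i} l≤i i<l+1 = ≤-antisym l≤i (s≤s⁻¹ (subst (i <_) (+-comm l 1) i<l+1))

covers-two : ∀ {l i} → l ≤ i → i < l + 2 → l ≡ i ⊎ suc l ≡ i
covers-two {l} {i} l≤i i<l+2 with m≤n⇒m<n∨m≡n l≤i
... | inj₂ l≡i = inj₁ l≡i
... | inj₁ l<i = inj₂ (≤-antisym l<i (s≤s⁻¹ (subst (i <_) (+-comm l 2) i<l+2)))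

covers⇒candidate : ∀ {i j} t → Covers (i , j) t → t ∈ candidates i j
covers⇒candidate (tile x y monomer) ((x≤ , <x) , (y≤ , <y))
  with refl ← covers-one x≤ <x | refl ← covers-one y≤ <y = here refl
covers⇒candidate (tile x y horizontalDimer) ((x≤ , <x) , (y≤ , <y))
  with refl ← covers-one x≤ <x | covers-two y≤ <y
... | inj₁ refl = there (here refl)
... | inj₂ refl = there (there (here refl))
covers⇒candidate (tile x y verticalDimer) ((x≤ , <x) , (y≤ , <y))
  with covers-two x≤ <x | covers-one y≤ <y
... | inj₁ refl | refl = there (there (∈-++⁺ʳ (leftCandidates x y) (here refl)))
... | inj₂ refl | refl = there (there (∈-++⁺ʳ (leftCandidates (suc x) y) (there (here refl))))

candidate⇒covers : ∀ i j {t} → t ∈ candidates i j → Covers (i , j) t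
candidate⇒covers i j (here refl) = (≤-refl , i<i+1 i) , (≤-refl , i<i+1 j)
candidate⇒covers i j (there (here refl)) = (≤-refl , i<i+1 i) , (≤-refl , i<i+2 j)
candidate⇒covers i j (there (there t∈)) with ∈-++⁻ (leftCandidates i j) t∈
candidate⇒covers i (suc j) (there (there t∈)) | inj₁ (here refl) = (≤-refl , i<i+1 i) , (n≤1+n j , 1+i<i+2 j)
candidate⇒covers i j (there (there t∈)) | inj₂ (here refl) = (≤-refl , i<i+2 i) , (≤-refl , i<i+1 j)
candidate⇒covers (suc i) j (there (there t∈)) | inj₂ (there (here refl)) = (n≤1+n i , 1+i<i+2 i) , (≤-refl , i<i+1 j)

module _ (M : ℕ) (χ : Tile → Bool) where

  private
    N = suc M
    n = suc N

  -- χ is arbitrary outside the grid, while the conditions on fields range over all of ℕ; the guard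
  -- makes the fields vanish there.
  present : Tile → Bool
  present t = does (fits? n n t) ∧ χ t

  opaque
    tiles : List Tile
    tiles = filter (isTrue? χ) (placements n n)

    tiles≡ : tiles ≡ filter (isTrue? χ) (placements n n)
    tiles≡ = refl

  opaque
    unfolding tiles

    ∈-tiles⁺ : ∀ {t} → present t ≡ true → t ∈ tiles
    ∈-tiles⁺ {t} on = let fits , χt = ∧-split on in
      ∈-filter⁺ (isTrue? χ) (∈-placements⁺ (does⇒ (fits? n n t) fits)) χt
  
    ∈-tiles⁻ : ∀ {t} → t ∈ tiles → Fits n n t × χ t ≡ true
    ∈-tiles⁻ t∈ = let t∈′ , on = ∈-filter⁻ (isTrue? χ) {xs = placements n n} t∈ in ∈-placements⁻ t∈′ , on

    tiles-unique : Unique tiles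
    tiles-unique = Unique.filter⁺ (isTrue? χ) (placements-unique n n)

  ∈-tiles⇒present : ∀ {t} → t ∈ tiles → present t ≡ true
  ∈-tiles⇒present {t} t∈ = let fits , on = ∈-tiles⁻ t∈ in cong₂ _∧_ (dec-true (fits? n n t) fits) on

  mono horiz vert : Field
  mono  i j = present (tile i j monomer)
  horiz i j = present (tile i j horizontalDimer)
  vert  i j = present (tile i j verticalDimer)

  present⇒fits : ∀ {t} → present t ≡ true → Fits n n t
  present⇒fits on = proj₁ (∈-tiles⁻ (∈-tiles⁺ on))

  horiz-range : ∀ {i j} → horiz i j ≡ true → i ≤ N × j ≤ M
  horiz-range {i} {j} on with present⇒fits on
  ... | b≤ , r≤ = s≤s⁻¹ (subst (_≤ n) (+-comm i 1) b≤) , s≤s⁻¹ (s≤s⁻¹ (subst (_≤ n) (+-comm j 2) r≤))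

  vert-range : ∀ {i j} → vert i j ≡ true → i ≤ M × j ≤ N
  vert-range {i} {j} on with present⇒fits on
  ... | b≤ , r≤ = s≤s⁻¹ (s≤s⁻¹ (subst (_≤ n) (+-comm i 2) b≤)) , s≤s⁻¹ (subst (_≤ n) (+-comm j 1) r≤)

  horiz-last : ∀ i → horiz i N ≡ false
  horiz-last i = ¬true⇒false λ on → <⇒≱ (n<1+n M) (proj₂ (horiz-range on))

  vert-last : ∀ j → vert N j ≡ false
  vert-last j = ¬true⇒false λ on → <⇒≱ (n<1+n M) (proj₁ (vert-range on))

  cover : ℕ → ℕ → ℕ
  cover = cellSum mono horiz vert

  count-present-∷ : ∀ t ts → count (isTrue? present) (t ∷ ts) ≡ ind (present t) + count (isTrue? present) ts
  count-present-∷ t ts = trans (count-∷ (isTrue? present) t ts)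
    (cong (λ b → ind b + count (isTrue? present) ts) (does-≟true (present t)))

  count-covers : ∀ i j → count (covers? (i , j)) tiles ≡ cover i j
  count-covers i j = trans
    (Unique-≋⇒length≡ (Unique.filter⁺ (covers? (i , j)) tiles-unique)
                      (Unique.filter⁺ (isTrue? present) (candidates-unique i j)) to from)
    (total i j)
    where
    to : ∀ {t} → t ∈ filter (covers? (i , j)) tiles → t ∈ filter (isTrue? present) (candidates i j)
    to {t} t∈ with ∈-filter⁻ (covers? (i , j)) {xs = tiles} t∈
    ... | t∈′ , cov = ∈-filter⁺ (isTrue? present) (covers⇒candidate t cov) (∈-tiles⇒present t∈′)
    from : ∀ {t} → t ∈ filter (isTrue? present) (candidates i j) → t ∈ filter (covers? (i , j)) tiles
    from t∈ with ∈-filter⁻ (isTrue? present) {xs = candidates i j} t∈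
    ... | t∈′ , on = ∈-filter⁺ (covers? (i , j)) (∈-tiles⁺ on) (candidate⇒covers i j t∈′)
    left-total : ∀ i j → count (isTrue? present) (leftCandidates i j) ≡ ind (shiftRight horiz i j)
    left-total i zero    = refl
    left-total i (suc j) = trans (count-present-∷ (tile i j horizontalDimer) []) (+-identityʳ _)
    up-total : ∀ i j → count (isTrue? present) (upCandidates i j) ≡ ind (shiftDown vert i j)
    up-total zero    j = refl
    up-total (suc i) j = trans (count-present-∷ (tile i j verticalDimer) []) (+-identityʳ _)
    total : ∀ i j → count (isTrue? present) (candidates i j) ≡ cover i j
    total i j =
      trans (count-present-∷ (tile i j monomer) _) (cong (ind (mono i j) +_)
      (trans (count-present-∷ (tile i j horizontalDimer) _)
      (trans (cong (ind (horiz i j) +_) (trans (count-++ (isTrue? present) (leftCandidates i j) _)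
        (cong₂ _+_ (left-total i j) (trans (count-present-∷ (tile i j verticalDimer) _)
          (cong (ind (vert i j) +_) (up-total i j))))))
        (sym (+-assoc (ind (horiz i j)) (ind (shiftRight horiz i j)) _)))))

  count-monomers : count isMonomer? tiles ≡ sum² n (indicate mono)
  count-monomers = trans
    (trans (Unique-≋⇒length≡ (Unique.filter⁺ isMonomer? tiles-unique)
             (Unique.map⁺ {f = monomerAt} (λ { refl → refl })
               (Unique.filter⁺ (isTrue? mono′) (Unique.cartesianProduct⁺ (Unique.upTo⁺ n) (Unique.upTo⁺ n))))
             to from)
           (length-map monomerAt (filter (isTrue? mono′) (cells n n))))
    (count-cells mono′ n)
    where
    monomerAt : ℕ × ℕ → Tile
    monomerAt (i , j) = tile i j monomer
    mono′ : ℕ × ℕ → Bool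
    mono′ (i , j) = mono i j
    to : ∀ {t} → t ∈ filter isMonomer? tiles → t ∈ map monomerAt (filter (isTrue? mono′) (cells n n))
    to {tile i j _} t∈ with ∈-filter⁻ isMonomer? {xs = tiles} t∈
    ... | t∈′ , refl with ∈-tiles⁻ t∈′
    ...   | (b≤ , r≤) , _ = ∈-map⁺ monomerAt (∈-filter⁺ (isTrue? mono′)
      (∈-cells (≤-trans (i<i+1 i) b≤) (≤-trans (i<i+1 j) r≤)) (∈-tiles⇒present t∈′))
    from : ∀ {t} → t ∈ map monomerAt (filter (isTrue? mono′) (cells n n)) → t ∈ filter isMonomer? tiles
    from t∈ with ∈-map⁻ monomerAt t∈
    ... | (i , j) , ij∈ , refl =
      ∈-filter⁺ isMonomer? (∈-tiles⁺ (proj₂ (∈-filter⁻ (isTrue? mono′) {xs = cells n n} ij∈))) refl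

-- From tatami tilings to tatami fields

∈-singleton : ∀ {A : Set} {xs : List A} → length xs ≡ 1 → ∀ {x y} → x ∈ xs → y ∈ xs → x ≡ y
∈-singleton {xs = _ ∷ []} _ (here refl) (here refl) = refl

∃∈-singleton : ∀ {A : Set} {xs : List A} → length xs ≡ 1 → ∃ λ x → x ∈ xs
∃∈-singleton {xs = x ∷ []} _ = x , here refl

double-injective : ∀ {m n} → m + m ≡ n + n → m ≡ n
double-injective eq = ≤-antisym (half-≤ (≤-reflexive eq)) (half-≤ (≤-reflexive (sym eq)))

∧-conflict : ∀ a b → (a ≡ true → b ≡ true → a ∧ b ≡ false) → a ∧ b ≡ false
∧-conflict true  true  f = f refl refl
∧-conflict true  false f = refl
∧-conflict false b     f = refl

total : (m h h′ v v′ : Bool) → ℕ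
total m h h′ v v′ = ind m + ((ind h + ind h′) + (ind v + ind v′))

total≡1⇒exclusive : ∀ m h h′ v v′ → total m h h′ v v′ ≡ 1 →
  h ∧ h′ ≡ false × h ∧ v ≡ false × h ∧ v′ ≡ false × h′ ∧ v ≡ false × h′ ∧ v′ ≡ false × v ∧ v′ ≡ false
total≡1⇒exclusive = toWitness {a? = ∀ᵇ? λ m → ∀ᵇ? λ h → ∀ᵇ? λ h′ → ∀ᵇ? λ v → ∀ᵇ? λ v′ →
  (total m h h′ v v′ ≟ 1) →-dec ((_ ≟ᵇ _) ×-dec ((_ ≟ᵇ _) ×-dec ((_ ≟ᵇ _) ×-dec
  ((_ ≟ᵇ _) ×-dec ((_ ≟ᵇ _) ×-dec (_ ≟ᵇ _))))))} tt

exclusive⇒total≡1 : ∀ h h′ v v′ →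
  h ∧ h′ ≡ false → h ∧ v ≡ false → h ∧ v′ ≡ false → h′ ∧ v ≡ false → h′ ∧ v′ ≡ false → v ∧ v′ ≡ false →
  total (not ((h ∨ h′) ∨ (v ∨ v′))) h h′ v v′ ≡ 1
exclusive⇒total≡1 = toWitness {a? = ∀ᵇ? λ h → ∀ᵇ? λ h′ → ∀ᵇ? λ v → ∀ᵇ? λ v′ →
  (h ∧ h′ ≟ᵇ false) →-dec ((h ∧ v ≟ᵇ false) →-dec ((h ∧ v′ ≟ᵇ false) →-dec ((h′ ∧ v ≟ᵇ false) →-dec
  ((h′ ∧ v′ ≟ᵇ false) →-dec ((v ∧ v′ ≟ᵇ false) →-dec
  (total (not ((h ∨ h′) ∨ (v ∨ v′))) h h′ v v′ ≟ 1))))))} tt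

total≡1⇒monomer : ∀ m h h′ v v′ → total m h h′ v v′ ≡ 1 → m ≡ not ((h ∨ h′) ∨ (v ∨ v′))
total≡1⇒monomer = toWitness {a? = ∀ᵇ? λ m → ∀ᵇ? λ h → ∀ᵇ? λ h′ → ∀ᵇ? λ v → ∀ᵇ? λ v′ →
  (total m h h′ v v′ ≟ 1) →-dec (m ≟ᵇ not ((h ∨ h′) ∨ (v ∨ v′)))} tt

module _ {M : ℕ} {χ : Tile → Bool} where

  private
    N = suc M
    n = suc N
    ts = tiles M χ
    H = horiz M χ
    V = vert M χ

  unique-cover : ∀ {i j} → cover M χ i j ≡ 1 → ∀ {t t′} → t ∈ ts → t′ ∈ ts →
                 Covers (i , j) t → Covers (i , j) t′ → t ≡ t′
  unique-cover {i} {j} eq t∈ t′∈ cov cov′ = ∈-singleton (trans (count-covers M χ i j) eq)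
    (∈-filter⁺ (covers? (i , j)) t∈ cov) (∈-filter⁺ (covers? (i , j)) t′∈ cov′)

  exists-cover : ∀ {i j} → cover M χ i j ≡ 1 → ∃ λ t → t ∈ ts × t ∈ candidates i j
  exists-cover {i} {j} eq with ∃∈-singleton (trans (count-covers M χ i j) eq)
  ... | t , t∈ = let t∈′ , cov = ∈-filter⁻ (covers? (i , j)) {xs = ts} t∈ in t , t∈′ , covers⇒candidate t cov

module _ {M : ℕ} {χ : Tile → Bool}
         (valid : IsTatamiTiling (suc (suc M)) (suc (suc M)) (suc (suc M)) (tiles M χ)) where

  private
    N = suc M
    n = suc N
    ts = tiles M χ
    H = horiz M χ
    V = vert M χ

  valid-cover : ∀ i j → i < n → j < n → cover M χ i j ≡ 1
  valid-cover i j i< j< = trans (sym (count-covers M χ i j)) (All.lookup (proj₁ valid) (∈-cells i< j<))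

  private
    exclusive : ∀ i j → i < n → j < n → let h = H i j; h′ = shiftRight H i j; v = V i j; v′ = shiftDown V i j in
      h ∧ h′ ≡ false × h ∧ v ≡ false × h ∧ v′ ≡ false × h′ ∧ v ≡ false × h′ ∧ v′ ≡ false × v ∧ v′ ≡ false
    exclusive i j i< j< = total≡1⇒exclusive (mono M χ i j) (H i j) (shiftRight H i j) (V i j) (shiftDown V i j)
                            (valid-cover i j i< j<)

    off : ∀ {t} → present M χ t ≡ false → t ∈ ts → ⊥
    off eq t∈ = contradiction (trans (sym eq) (∈-tiles⇒present M χ t∈)) λ ()

    -- The dimers that leave the cell (a, b) to the right or downwards are the up and left arms of
    -- the point at its lower right corner. Any other tile that covers the cell has a corner at this
    -- point.
    corner-nw : ∀ a b → a < n → b < n → H a b ≡ false → V a b ≡ false →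
                ∃ λ t → t ∈ ts × bottom t ≡ suc a × right t ≡ suc b
    corner-nw a b a< b< noH noV with exists-cover {M} {χ} (valid-cover a b a< b<)
    ... | t , t∈ , here refl = t , t∈ , +-comm a 1 , +-comm b 1
    ... | t , t∈ , there (here refl) = ⊥-elim (off noH t∈)
    ... | t , t∈ , there (there c) with ∈-++⁻ (leftCandidates a b) c
    corner-nw a (suc b) a< b< noH noV | t , t∈ , _ | inj₁ (here refl) = t , t∈ , +-comm a 1 , +-comm b 2
    ... | inj₂ (here refl) = ⊥-elim (off noV t∈)
    corner-nw (suc a) b a< b< noH noV | t , t∈ , _ | inj₂ (there (here refl)) = t , t∈ , +-comm a 2 , +-comm b 1

    corner-ne : ∀ a b → a < n → suc b < n → H a b ≡ false → V a (suc b) ≡ false →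
                ∃ λ t → t ∈ ts × bottom t ≡ suc a × left t ≡ suc b
    corner-ne a b a< b< noH noV with exists-cover {M} {χ} (valid-cover a (suc b) a< b<)
    ... | t , t∈ , here refl = t , t∈ , +-comm a 1 , refl
    ... | t , t∈ , there (here refl) = t , t∈ , +-comm a 1 , refl
    ... | t , t∈ , there (there (here refl)) = ⊥-elim (off noH t∈)
    ... | t , t∈ , there (there (there (here refl))) = ⊥-elim (off noV t∈)
    corner-ne (suc a) b a< b< noH noV | t , t∈ , there (there (there (there (here refl)))) =
      t , t∈ , +-comm a 2 , refl

    corner-sw : ∀ a b → suc a < n → b < n → H (suc a) b ≡ false → V a b ≡ false →
                ∃ λ t → t ∈ ts × top t ≡ suc a × right t ≡ suc b
    corner-sw a b a< b< noH noV with exists-cover {M} {χ} (valid-cover (suc a) b a< b<)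
    ... | t , t∈ , here refl = t , t∈ , refl , +-comm b 1
    ... | t , t∈ , there (here refl) = ⊥-elim (off noH t∈)
    ... | t , t∈ , there (there c) with ∈-++⁻ (leftCandidates (suc a) b) c
    corner-sw a (suc b) a< b< noH noV | t , t∈ , _ | inj₁ (here refl) = t , t∈ , refl , +-comm b 2
    ... | inj₂ (here refl) = t , t∈ , refl , +-comm b 1
    ... | inj₂ (there (here refl)) = ⊥-elim (off noV t∈)

    corner-se : ∀ a b → suc a < n → suc b < n → H (suc a) b ≡ false → V a (suc b) ≡ false →
                ∃ λ t → t ∈ ts × top t ≡ suc a × left t ≡ suc b
    corner-se a b a< b< noH noV with exists-cover {M} {χ} (valid-cover (suc a) (suc b) a< b<)
    ... | t , t∈ , here refl = t , t∈ , refl , refl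
    ... | t , t∈ , there (here refl) = t , t∈ , refl , refl
    ... | t , t∈ , there (there (here refl)) = ⊥-elim (off noH t∈)
    ... | t , t∈ , there (there (there (here refl))) = t , t∈ , refl , refl
    ... | t , t∈ , there (there (there (there (here refl)))) = ⊥-elim (off noV t∈)

    right≢left : ∀ {t t′ y} → right t ≡ y → left t′ ≡ y → t ≢ t′
    right≢left {t} r l refl = <⇒≢ (left<right t) (trans l (sym r))

    bottom≢top : ∀ {t t′ x} → bottom t ≡ x → top t′ ≡ x → t ≢ t′
    bottom≢top {t} b u refl = <⇒≢ (top<bottom t) (trans u (sym b))

    -- Without arms, the tiles on the four surrounding cells each end at the point. They lie on
    -- different sides of it, so they are four distinct tiles with a common corner.
    no-arm⇒⊥ : ∀ a b → a ≤ M → b ≤ M → H a b ≡ false → V a b ≡ false → H (suc a) b ≡ false →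
               V a (suc b) ≡ false → ⊥
    no-arm⇒⊥ a b a≤ b≤ u l d r
      with corner-nw a b (s≤s (m≤n⇒m≤1+n a≤)) (s≤s (m≤n⇒m≤1+n b≤)) u l
         | corner-ne a b (s≤s (m≤n⇒m≤1+n a≤)) (s≤s (s≤s b≤)) u r
         | corner-sw a b (s≤s (s≤s a≤)) (s≤s (m≤n⇒m≤1+n b≤)) d l
         | corner-se a b (s≤s (s≤s a≤)) (s≤s (s≤s b≤)) d r
    ... | t₁ , ∈₁ , b₁ , r₁ | t₂ , ∈₂ , b₂ , l₂ | t₃ , ∈₃ , u₃ , r₃ | t₄ , ∈₄ , u₄ , l₄ =
      <⇒≱ (All.lookup (proj₁ (proj₂ valid)) {suc a , suc b}
             (∈-cells (s≤s (s≤s (m≤n⇒m≤1+n a≤))) (s≤s (s≤s (m≤n⇒m≤1+n b≤)))))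
          (Unique-⊆⇒length≤ {xs = t₁ ∷ t₂ ∷ t₃ ∷ t₄ ∷ []} distinct sub)
      where
      distinct : Unique (t₁ ∷ t₂ ∷ t₃ ∷ t₄ ∷ [])
      distinct = (right≢left {t₁} r₁ l₂ ∷ bottom≢top {t₁} b₁ u₃ ∷ bottom≢top {t₁} b₁ u₄ ∷ []) ∷
                 (bottom≢top {t₂} b₂ u₃ ∷ bottom≢top {t₂} b₂ u₄ ∷ []) ∷ (right≢left {t₃} r₃ l₄ ∷ []) ∷ [] ∷ []
      sub : ∀ {t} → t ∈ t₁ ∷ t₂ ∷ t₃ ∷ t₄ ∷ [] → t ∈ filter (hasCorner? (suc a , suc b)) ts
      sub (here refl) = ∈-filter⁺ (hasCorner? (suc a , suc b)) ∈₁ (inj₂ (sym b₁) , inj₂ (sym r₁))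
      sub (there (here refl)) = ∈-filter⁺ (hasCorner? (suc a , suc b)) ∈₂ (inj₂ (sym b₂) , inj₁ (sym l₂))
      sub (there (there (here refl))) = ∈-filter⁺ (hasCorner? (suc a , suc b)) ∈₃ (inj₁ (sym u₃) , inj₂ (sym r₃))
      sub (there (there (there (here refl)))) = ∈-filter⁺ (hasCorner? (suc a , suc b)) ∈₄ (inj₁ (sym u₄) , inj₁ (sym l₄))

  valid⇒tatamiField : IsTatamiField M H V
  valid⇒tatamiField = record
    { hh = λ i j → ∧-conflict (H i j) (H i (suc j)) λ p q → let i≤ , j≤ = horiz-range M χ {i} {suc j} q in
        trans (∧-comm (H i j) (H i (suc j))) (proj₁ (exclusive i (suc j) (s≤s i≤) (s≤s (m≤n⇒m≤1+n j≤))))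
    ; vv = λ i j → ∧-conflict (V i j) (V (suc i) j) λ p q → let i≤ , j≤ = vert-range M χ {suc i} {j} q in
        trans (∧-comm (V i j) (V (suc i) j))
          (proj₂ (proj₂ (proj₂ (proj₂ (proj₂ (exclusive (suc i) j (s≤s (m≤n⇒m≤1+n i≤)) (s≤s j≤)))))))
    ; up-left = λ i j → ∧-conflict (H i j) (V i j) λ p q →
        proj₁ (proj₂ (exclusive i j (row {i} {j} p) (column {i} {j} q)))
    ; up-right = λ i j → ∧-conflict (H i j) (V i (suc j)) λ p q →
        proj₁ (proj₂ (proj₂ (proj₂ (exclusive i (suc j) (row {i} {j} p) (column {i} {suc j} q)))))
    ; down-left = λ i j → ∧-conflict (H (suc i) j) (V i j) λ p q →
        proj₁ (proj₂ (proj₂ (exclusive (suc i) j (row {suc i} {j} p) (column {i} {j} q))))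
    ; down-right = λ i j → ∧-conflict (H (suc i) j) (V i (suc j)) λ p q →
        proj₁ (proj₂ (proj₂ (proj₂ (proj₂ (exclusive (suc i) (suc j) (row {suc i} {j} p) (column {i} {suc j} q))))))
    ; arm = arm
    }
    where
    row : ∀ {i j} → H i j ≡ true → i < n
    row {i} {j} p = s≤s (proj₁ (horiz-range M χ {i} {j} p))
    column : ∀ {i j} → V i j ≡ true → j < n
    column {i} {j} q = s≤s (proj₂ (vert-range M χ {i} {j} q))
    arm : ∀ a b → a ≤ M → b ≤ M → (H a b ∨ V a b) ∨ (H (suc a) b ∨ V a (suc b)) ≡ true
    arm a b a≤ b≤ with H a b in u | V a b in l | H (suc a) b in d | V a (suc b) in r
    ... | true  | _     | _     | _     = refl
    ... | false | true  | _     | _     = refl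
    ... | false | false | true  | _     = refl
    ... | false | false | false | true  = refl
    ... | false | false | false | false = ⊥-elim (no-arm⇒⊥ a b a≤ b≤ u l d r)

  -- Counting cells gives n + 2E = n² because there are n monomers, and 2 `pairs` = n(n - 1); so E
  -- attains its lower bound.
  valid⇒extremal : edges M (indicate H) (indicate V) ≡ pairs M
  valid⇒extremal = double-injective (+-cancelˡ-≡ n _ _ (begin
    n + (E + E)                             ≡⟨ cong (_+ (E + E)) (trans (sym (proj₂ (proj₂ valid))) (count-monomers M χ)) ⟩
    sum² n (indicate (mono M χ)) + (E + E)  ≡⟨ sym (area M (mono M χ) H V (horiz-last M χ) (vert-last M χ) valid-cover) ⟩
    n * n                                   ≡⟨ cong (n +_) (sym (pairs+pairs M)) ⟩
    n + (pairs M + pairs M)                 ∎))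
    where
    open ≡-Reasoning
    E = edges M (indicate H) (indicate V)

-- Drawing a tatami tiling from aligned fields

arms-exclusive : ∀ h g → isUp h g ∧ isLeft h g ≡ false × isUp h g ∧ isRight h g ≡ false ×
                         isDown h g ∧ isLeft h g ≡ false × isDown h g ∧ isRight h g ≡ false ×
                         (isUp h g ∨ isLeft h g) ∨ (isDown h g ∨ isRight h g) ≡ true ×
                         ind (isUp h g) + ind (isLeft h g) ≡ ind (not g) ×
                         ind (isDown h g) + ind (isRight h g) ≡ ind g
arms-exclusive = toWitness {a? = ∀ᵇ? λ h → ∀ᵇ? λ g → (_ ≟ᵇ _) ×-dec ((_ ≟ᵇ _) ×-dec ((_ ≟ᵇ _) ×-dec
  ((_ ≟ᵇ _) ×-dec ((_ ≟ᵇ _) ×-dec ((_ ≟ _) ×-dec (_ ≟ _))))))} tt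

arms-injective : ∀ h g h′ g′ → isUp h g ≡ isUp h′ g′ → isDown h g ≡ isDown h′ g′ →
                 isLeft h g ≡ isLeft h′ g′ → h ≡ h′ × g ≡ g′
arms-injective = toWitness {a? = ∀ᵇ? λ h → ∀ᵇ? λ g → ∀ᵇ? λ h′ → ∀ᵇ? λ g′ →
  (_ ≟ᵇ _) →-dec ((_ ≟ᵇ _) →-dec ((_ ≟ᵇ _) →-dec ((_ ≟ᵇ _) ×-dec (_ ≟ᵇ _))))} tt

module Drawing (M : ℕ) (h g : Field) where

  private
    N = suc M
    n = suc N

  -- Each edge is read at its upper or left end, except on the top and left border, where only the
  -- other end is an interior point. The raw bits mean nothing outside the grid, so they are cut off
  -- before the uncovered cells receive monomers.
  rawH rawV H⁺ V⁺ : Field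
  rawH zero    j = isUp (h 0 j) (g 0 j)
  rawH (suc i) j = isDown (h i j) (g i j)
  rawV i zero    = isLeft (h i 0) (g i 0)
  rawV i (suc j) = isRight (h i j) (g i j)
  H⁺ i j = does (fits? n n (tile i j horizontalDimer)) ∧ rawH i j
  V⁺ i j = does (fits? n n (tile i j verticalDimer)) ∧ rawV i j

  drawn : Tile → Bool
  drawn (tile i j monomer)         = not ((H⁺ i j ∨ shiftRight H⁺ i j) ∨ (V⁺ i j ∨ shiftDown V⁺ i j))
  drawn (tile i j horizontalDimer) = rawH i j
  drawn (tile i j verticalDimer)   = rawV i j

open Drawing using (drawn; rawH; rawV; H⁺; V⁺)

module _ {M : ℕ} where
  private
    N = suc M
    n = suc N

  horiz-fits : ∀ {i j} → i ≤ N → j ≤ M → Fits n n (tile i j horizontalDimer)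
  horiz-fits {i} {j} i≤ j≤ = subst (_≤ n) (+-comm 1 i) (s≤s i≤) , subst (_≤ n) (+-comm 2 j) (s≤s (s≤s j≤))

  vert-fits : ∀ {i j} → i ≤ M → j ≤ N → Fits n n (tile i j verticalDimer)
  vert-fits {i} {j} i≤ j≤ = subst (_≤ n) (+-comm 2 i) (s≤s (s≤s i≤)) , subst (_≤ n) (+-comm 1 j) (s≤s j≤)

  mono-fits : ∀ {i j} → i ≤ N → j ≤ N → Fits n n (tile i j monomer)
  mono-fits {i} {j} i≤ j≤ = subst (_≤ n) (+-comm 1 i) (s≤s i≤) , subst (_≤ n) (+-comm 1 j) (s≤s j≤)

  present-fits : ∀ χ t → Fits n n t → present M χ t ≡ χ t
  present-fits χ t fits = cong (_∧ χ t) (dec-true (fits? n n t) fits)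

module _ {M : ℕ} {h g : Field} (aligned : Aligned M h g) where

  private
    N = suc M
    n = suc N
    χ = drawn M h g
    ts = tiles M χ
    H = horiz M χ
    V = vert M χ

  open Aligned aligned

  -- An up or left arm has been drawn from the neighbouring point, if there is one; the fitting
  -- rules make the readings at both ends agree.
  drawn-arms : ∀ a b → a ≤ M → b ≤ M → Arms H V h g a b
  drawn-arms a b a≤ b≤ =
      trans (raw-up a b a≤ b≤) (sym (present-fits χ (tile a b horizontalDimer) (horiz-fits (m≤n⇒m≤1+n a≤) b≤)))
    , sym (present-fits χ (tile (suc a) b horizontalDimer) (horiz-fits (s≤s a≤) b≤))
    , trans (raw-left a b a≤ b≤) (sym (present-fits χ (tile a b verticalDimer) (vert-fits a≤ (m≤n⇒m≤1+n b≤))))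
    , sym (present-fits χ (tile a (suc b) verticalDimer) (vert-fits a≤ (s≤s b≤)))
    where
    raw-up : ∀ a b → a ≤ M → b ≤ M → isUp (h a b) (g a b) ≡ rawH M h g a b
    raw-up zero    b _  _  = refl
    raw-up (suc a) b a< b≤ = sym (proj₁ (ver a b a< b≤))
    raw-left : ∀ a b → a ≤ M → b ≤ M → isLeft (h a b) (g a b) ≡ rawV M h g a b
    raw-left a zero    _  _  = refl
    raw-left a (suc b) a≤ b< = sym (proj₁ (hor a b a≤ b<))

  drawn-tatamiField : IsTatamiField M H V
  drawn-tatamiField = record
    { hh = λ i j → ∧-conflict (H i j) (H i (suc j)) λ p q →
        let i≤ , j< = horiz-range M χ {i} {suc j} q in hh i j i≤ j<
    ; vv = λ i j → ∧-conflict (V i j) (V (suc i) j) λ p q →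
        let i< , j≤ = vert-range M χ {suc i} {j} q in vv i j i< j≤
    ; up-left = λ i j → ∧-conflict (H i j) (V i j) λ p q →
        let u , d , l , r = vertex i j i j p q in
        trans (cong₂ _∧_ (sym u) (sym l)) (proj₁ (arms-exclusive (h i j) (g i j)))
    ; up-right = λ i j → ∧-conflict (H i j) (V i (suc j)) λ p q →
        let u , d , l , r = vertex i j i (suc j) p q in
        trans (cong₂ _∧_ (sym u) (sym r)) (proj₁ (proj₂ (arms-exclusive (h i j) (g i j))))
    ; down-left = λ i j → ∧-conflict (H (suc i) j) (V i j) λ p q →
        let u , d , l , r = vertex i j (suc i) j p q in
        trans (cong₂ _∧_ (sym d) (sym l)) (proj₁ (proj₂ (proj₂ (arms-exclusive (h i j) (g i j)))))
    ; down-right = λ i j → ∧-conflict (H (suc i) j) (V i (suc j)) λ p q →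
        let u , d , l , r = vertex i j (suc i) (suc j) p q in
        trans (cong₂ _∧_ (sym d) (sym r)) (proj₁ (proj₂ (proj₂ (proj₂ (arms-exclusive (h i j) (g i j))))))
    ; arm = λ a b a≤ b≤ → let u , d , l , r = drawn-arms a b a≤ b≤ in
        trans (cong₂ _∨_ (cong₂ _∨_ (sym u) (sym l)) (cong₂ _∨_ (sym d) (sym r)))
          (proj₁ (proj₂ (proj₂ (proj₂ (proj₂ (arms-exclusive (h a b) (g a b)))))))
    }
    where
    vertex : ∀ i j i′ j′ → H i′ j ≡ true → V i j′ ≡ true → Arms H V h g i j
    vertex i j i′ j′ p q = drawn-arms i j (proj₁ (vert-range M χ {i} {j′} q)) (proj₂ (horiz-range M χ {i′} {j} p))
    hh : ∀ i j → i ≤ N → j < M → H i j ∧ H i (suc j) ≡ false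
    hh zero    j _  j< = trans (cong₂ _∧_ (sym (proj₁ (drawn-arms 0 j z≤n (<⇒≤ j<)))) (sym (proj₁ (drawn-arms 0 (suc j) z≤n j<))))
      (proj₁ (proj₂ (hor 0 j z≤n j<)))
    hh (suc i) j i≤ j< = trans (cong₂ _∧_ (sym (proj₁ (proj₂ (drawn-arms i j (s≤s⁻¹ i≤) (<⇒≤ j<)))))
                                          (sym (proj₁ (proj₂ (drawn-arms i (suc j) (s≤s⁻¹ i≤) j<)))))
      (proj₂ (proj₂ (hor i j (s≤s⁻¹ i≤) j<)))
    vv : ∀ i j → i < M → j ≤ N → V i j ∧ V (suc i) j ≡ false
    vv i zero    i< _  = trans (cong₂ _∧_ (sym (proj₁ (proj₂ (proj₂ (drawn-arms i 0 (<⇒≤ i<) z≤n)))))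
                                          (sym (proj₁ (proj₂ (proj₂ (drawn-arms (suc i) 0 i< z≤n))))))
      (proj₁ (proj₂ (ver i 0 i< z≤n)))
    vv i (suc j) i< j≤ = trans (cong₂ _∧_ (sym (proj₂ (proj₂ (proj₂ (drawn-arms i j (<⇒≤ i<) (s≤s⁻¹ j≤))))))
                                          (sym (proj₂ (proj₂ (proj₂ (drawn-arms (suc i) j i< (s≤s⁻¹ j≤)))))))
      (proj₂ (proj₂ (ver i j i< (s≤s⁻¹ j≤))))

  open IsTatamiField drawn-tatamiField

  drawn-cover : ∀ i j → i < n → j < n → cover M χ i j ≡ 1
  drawn-cover i j i< j< = trans
    (cong (λ m → total m (H i j) (shiftRight H i j) (V i j) (shiftDown V i j))
      (trans (present-fits χ (tile i j monomer) (mono-fits (s≤s⁻¹ i<) (s≤s⁻¹ j<))) (mono-shift i j)))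
    (exclusive⇒total≡1 (H i j) (shiftRight H i j) (V i j) (shiftDown V i j)
      (right-conflict i j) (up-left i j) (down-conflict i j) (left-conflict i j) (corner-conflict i j) (below-conflict i j))
    where
    mono-shift : ∀ i j → drawn M h g (tile i j monomer) ≡ not ((H i j ∨ shiftRight H i j) ∨ (V i j ∨ shiftDown V i j))
    mono-shift zero    zero    = refl
    mono-shift zero    (suc j) = refl
    mono-shift (suc i) zero    = refl
    mono-shift (suc i) (suc j) = refl
    right-conflict : ∀ i j → H i j ∧ shiftRight H i j ≡ false
    right-conflict i zero    = ∧-zeroʳ _
    right-conflict i (suc j) = trans (∧-comm (H i (suc j)) (H i j)) (hh i j)
    down-conflict : ∀ i j → H i j ∧ shiftDown V i j ≡ false
    down-conflict zero    j = ∧-zeroʳ _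
    down-conflict (suc i) j = down-left i j
    left-conflict : ∀ i j → shiftRight H i j ∧ V i j ≡ false
    left-conflict i zero    = refl
    left-conflict i (suc j) = up-right i j
    corner-conflict : ∀ i j → shiftRight H i j ∧ shiftDown V i j ≡ false
    corner-conflict i       zero    = refl
    corner-conflict zero    (suc j) = ∧-zeroʳ _
    corner-conflict (suc i) (suc j) = down-right i j
    below-conflict : ∀ i j → V i j ∧ shiftDown V i j ≡ false
    below-conflict zero    j = ∧-zeroʳ _
    below-conflict (suc i) j = trans (∧-comm (V (suc i) j) (V i j)) (vv i j)

  drawn-tiling : IsTiling n n ts
  drawn-tiling = All.tabulate λ {(i , j)} ij∈ → let i< , j< = ∈-cells⁻ {n} {n} ij∈ in
    trans (count-covers M χ i j) (drawn-cover i j i< j<)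

  drawn-monomers : count isMonomer? ts ≡ n
  drawn-monomers = trans (count-monomers M χ) (+-cancelʳ-≡ (E + E) _ n (begin
    sum² n (indicate (mono M χ)) + (E + E)  ≡⟨ sym (area M (mono M χ) H V (horiz-last M χ) (vert-last M χ) drawn-cover) ⟩
    n * n                                   ≡⟨ cong (n +_) (sym (pairs+pairs M)) ⟩
    n + (pairs M + pairs M)                 ≡⟨ cong (λ e → n + (e + e)) (sym E≡pairs) ⟩
    n + (E + E)                             ∎))
    where
    open ≡-Reasoning
    E = edges M (indicate H) (indicate V)
    E≡pairs : E ≡ pairs M
    E≡pairs = aligned-extremal {H = H} {V} {g} diag
      (λ a b a≤ b≤ → let u , d , l , r = drawn-arms a b a≤ b≤ in
        trans (cong₂ (λ x y → ind x + ind y) (sym u) (sym l))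
          (proj₁ (proj₂ (proj₂ (proj₂ (proj₂ (proj₂ (arms-exclusive (h a b) (g a b)))))))))
      (λ a b a≤ b≤ → let u , d , l , r = drawn-arms a b a≤ b≤ in
        trans (cong₂ (λ x y → ind x + ind y) (sym d) (sym r))
          (proj₂ (proj₂ (proj₂ (proj₂ (proj₂ (proj₂ (arms-exclusive (h a b) (g a b)))))))))

  -- Each cell is covered by exactly one tile, so two cells account for at most two tiles. It
  -- therefore suffices to confine the tiles at a point to one row or one column.
  few-corners : ∀ q c c′ → c ∈ cells n n → c′ ∈ cells n n →
    (∀ {t} → t ∈ ts → HasCorner q t → Covers c t ⊎ Covers c′ t) → count (hasCorner? q) ts < 4
  few-corners q c c′ c∈ c′∈ cov = ≤-trans (s≤s (≤-trans
    (Unique-⊆⇒length≤ (Unique.filter⁺ (hasCorner? q) (tiles-unique M χ)) sub)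
    (≤-reflexive (trans (length-++ (filter (covers? c) ts))
      (cong₂ _+_ (All.lookup drawn-tiling c∈) (All.lookup drawn-tiling c′∈)))))) (s≤s (s≤s (s≤s z≤n)))
    where
    sub : ∀ {t} → t ∈ filter (hasCorner? q) ts → t ∈ filter (covers? c) ts ++ filter (covers? c′) ts
    sub t∈ with ∈-filter⁻ (hasCorner? q) {xs = ts} t∈
    ... | t∈′ , corner with cov t∈′ corner
    ...   | inj₁ covers = ∈-++⁺ˡ (∈-filter⁺ (covers? c) t∈′ covers)
    ...   | inj₂ covers = ∈-++⁺ʳ (filter (covers? c) ts) (∈-filter⁺ (covers? c′) t∈′ covers)

  -- Along one axis, a tile [l , u) ending at the coordinate x contains the cell
  -- before or the cell after x, where these are clamped to the grid.
  span-end : ∀ {l u x} → l < u → u ≤ n → x ≡ l ⊎ x ≡ u →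
             (l ≤ x ∸ 1 × x ∸ 1 < u) ⊎ (l ≤ x ⊓ N × x ⊓ N < u)
  span-end {l} {u} l<u u≤n (inj₁ refl) =
    inj₂ (subst (λ z → l ≤ z × z < u) (sym (m≤n⇒m⊓n≡m (s≤s⁻¹ (≤-trans l<u u≤n)))) (≤-refl , l<u))
  span-end {l} {suc u} l<u u≤n (inj₂ refl) = inj₁ (s≤s⁻¹ l<u , ≤-refl)

  end-low : ∀ {l u} → l < u → 0 ≡ l ⊎ 0 ≡ u → l ≤ 0 × 0 < u
  end-low l<u (inj₁ refl) = ≤-refl , l<u
  end-low () (inj₂ refl)

  end-high : ∀ {l u} → l < u → u ≤ n → n ≡ l ⊎ n ≡ u → l ≤ N × N < u
  end-high l<u u≤n (inj₁ refl) = contradiction u≤n (<⇒≱ l<u)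
  end-high l<u u≤n (inj₂ refl) = s≤s⁻¹ l<u , ≤-refl

  drawn-tatami : IsTatami n n ts
  drawn-tatami = All.tabulate λ {(x , y)} xy∈ →
    let x< , y< = ∈-cells⁻ {suc n} {suc n} xy∈ in at-point x y (s≤s⁻¹ x<) (s≤s⁻¹ y<)
    where
    fits : ∀ {t} → t ∈ ts → Fits n n t
    fits t∈ = proj₁ (∈-tiles⁻ M χ t∈)

    before< : ∀ {x} → x ≤ n → x ∸ 1 < n
    before< {zero}  _  = s≤s z≤n
    before< {suc x} x≤ = x≤

    after< : ∀ x → x ⊓ N < n
    after< x = s≤s (m⊓n≤n x N)

    in-row : ∀ r x y → r < n → y ≤ n → (∀ {t} → t ∈ ts → HasCorner (x , y) t → top t ≤ r × r < bottom t) →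
             count (hasCorner? (x , y)) ts < 4
    in-row r x y r< y≤ rows = few-corners (x , y) (r , y ∸ 1) (r , y ⊓ N)
      (∈-cells r< (before< y≤)) (∈-cells r< (after< y)) λ {t} t∈ corner →
        [ (λ c → inj₁ (rows t∈ corner , c)) , (λ c → inj₂ (rows t∈ corner , c)) ]′
        (span-end (left<right t) (proj₂ (fits t∈)) (proj₂ corner))

    in-column : ∀ r x y → r < n → x ≤ n → (∀ {t} → t ∈ ts → HasCorner (x , y) t → left t ≤ r × r < right t) →
                count (hasCorner? (x , y)) ts < 4
    in-column r x y r< x≤ columns = few-corners (x , y) (x ∸ 1 , r) (x ⊓ N , r)
      (∈-cells (before< x≤) r<) (∈-cells (after< x) r<) λ {t} t∈ corner →
        [ (λ c → inj₁ (c , columns t∈ corner)) , (λ c → inj₂ (c , columns t∈ corner)) ]′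
        (span-end (top<bottom t) (proj₁ (fits t∈)) (proj₁ corner))

    same : ∀ {i j t d} → i < n → j < n → t ∈ ts → d ∈ ts → Covers (i , j) t → Covers (i , j) d → t ≡ d
    same i< j< = unique-cover {M} {χ} (drawn-cover _ _ i< j<)

    module Interior (a b : ℕ) (a≤ : a ≤ M) (b≤ : b ≤ M) where
      a< : a < n
      a< = s≤s (m≤n⇒m≤1+n a≤)
      b< : b < n
      b< = s≤s (m≤n⇒m≤1+n b≤)
      a<′ : suc a < n
      a<′ = s≤s (s≤s a≤)
      b<′ : suc b < n
      b<′ = s≤s (s≤s b≤)

      rows : ∀ {t} → t ∈ ts → HasCorner (suc a , suc b) t →
             (top t ≤ a × a < bottom t) ⊎ (top t ≤ suc a × suc a < bottom t)
      rows {t} t∈ (corner , _) =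
        subst (λ z → (top t ≤ a × a < bottom t) ⊎ (top t ≤ z × z < bottom t)) (cong suc (m≤n⇒m⊓n≡m a≤))
          (span-end (top<bottom t) (proj₁ (fits t∈)) corner)

      columns : ∀ {t} → t ∈ ts → HasCorner (suc a , suc b) t →
                (left t ≤ b × b < right t) ⊎ (left t ≤ suc b × suc b < right t)
      columns {t} t∈ (_ , corner) =
        subst (λ z → (left t ≤ b × b < right t) ⊎ (left t ≤ z × z < right t)) (cong suc (m≤n⇒m⊓n≡m b≤))
          (span-end (left<right t) (proj₂ (fits t∈)) corner)

      bounded-rows : ∀ {r} → r < n → (∀ {t} → t ∈ ts → HasCorner (suc a , suc b) t → top t ≤ r × r < bottom t) →
                     count (hasCorner? (suc a , suc b)) ts < 4
      bounded-rows {r} r< = in-row r (suc a) (suc b) r< (s≤s (m≤n⇒m≤1+n b≤))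

      bounded-columns : ∀ {r} → r < n → (∀ {t} → t ∈ ts → HasCorner (suc a , suc b) t → left t ≤ r × r < right t) →
                        count (hasCorner? (suc a , suc b)) ts < 4
      bounded-columns {r} r< = in-column r (suc a) (suc b) r< (s≤s (m≤n⇒m≤1+n a≤))

      not-inside : ∀ x → suc x ≡ x ⊎ suc x ≡ x + 2 → ⊥
      not-inside x (inj₂ eq) = <⇒≢ (1+i<i+2 x) eq

      -- A dimer along an arm covers both cells of one row or column at the point,
      -- so that the tiles with a corner at the point are confined to the other one.
      horizontal-arm : ∀ i → H i b ≡ true → i < n → ∀ {t} → t ∈ ts → HasCorner (suc a , suc b) t →
                       (top t ≤ i × i < bottom t) → ⊥
      horizontal-arm i on i< {t} t∈ corner row with columns t∈ corner
      ... | inj₁ column with refl ← same i< b< t∈ (∈-tiles⁺ M χ {tile i b horizontalDimer} on)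
        (row , column) ((≤-refl , i<i+1 i) , (≤-refl , i<i+2 b)) =
        not-inside b (proj₂ corner)
      ... | inj₂ column with refl ← same i< b<′ t∈ (∈-tiles⁺ M χ {tile i b horizontalDimer} on)
        (row , column) ((≤-refl , i<i+1 i) , (n≤1+n b , 1+i<i+2 b)) =
        not-inside b (proj₂ corner)

      vertical-arm : ∀ j → V a j ≡ true → j < n → ∀ {t} → t ∈ ts → HasCorner (suc a , suc b) t →
                     (left t ≤ j × j < right t) → ⊥
      vertical-arm j on j< {t} t∈ corner column with rows t∈ corner
      ... | inj₁ row with refl ← same a< j< t∈ (∈-tiles⁺ M χ {tile a j verticalDimer} on)
        (row , column) ((≤-refl , i<i+2 a) , (≤-refl , i<i+1 j)) =
        not-inside a (proj₁ corner)
      ... | inj₂ row with refl ← same a<′ j< t∈ (∈-tiles⁺ M χ {tile a j verticalDimer} on)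
        (row , column) ((n≤1+n a , 1+i<i+2 a) , (≤-refl , i<i+1 j)) =
        not-inside a (proj₁ corner)

      corners : count (hasCorner? (suc a , suc b)) ts < 4
      corners with H a b in u | V a b in l | H (suc a) b in d | V a (suc b) in r | arm a b a≤ b≤
      ... | true  | _     | _     | _     | _ = bounded-rows a<′ λ t∈ c →
        [ (λ row → ⊥-elim (horizontal-arm a u a< t∈ c row)) , (λ row → row) ]′ (rows t∈ c)
      ... | false | true  | _     | _     | _ = bounded-columns b<′ λ t∈ c →
        [ (λ col → ⊥-elim (vertical-arm b l b< t∈ c col)) , (λ col → col) ]′ (columns t∈ c)
      ... | false | false | true  | _     | _ = bounded-rows a< λ t∈ c →
        [ (λ row → row) , (λ row → ⊥-elim (horizontal-arm (suc a) d a<′ t∈ c row)) ]′ (rows t∈ c)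
      ... | false | false | false | true  | _ = bounded-columns b< λ t∈ c →
        [ (λ col → col) , (λ col → ⊥-elim (vertical-arm (suc b) r b<′ t∈ c col)) ]′ (columns t∈ c)
      ... | false | false | false | false | ()

    -- On the border every tile with a corner at the point reaches into the outermost row or column,
    -- so two cells suffice there without any arm.
    at-point : ∀ x y → x ≤ n → y ≤ n → count (hasCorner? (x , y)) ts < 4
    at-point zero    y       x≤ y≤ = in-row 0 0 y (s≤s z≤n) y≤ λ {t} _ c → end-low (top<bottom t) (proj₁ c)
    at-point (suc a) zero    x≤ y≤ =
      in-column 0 (suc a) 0 (s≤s z≤n) x≤ λ {t} _ c → end-low (left<right t) (proj₂ c)
    at-point (suc a) (suc b) x≤ y≤ with m≤n⇒m<n∨m≡n x≤ | m≤n⇒m<n∨m≡n y≤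
    ... | inj₂ refl | _ = in-row N n (suc b) ≤-refl y≤ λ {t} t∈ c →
      end-high (top<bottom t) (proj₁ (fits t∈)) (proj₁ c)
    ... | inj₁ _ | inj₂ refl = in-column N (suc a) n ≤-refl x≤ λ {t} t∈ c →
      end-high (left<right t) (proj₂ (fits t∈)) (proj₂ c)
    ... | inj₁ x< | inj₁ y< = Interior.corners a b (s≤s⁻¹ (s≤s⁻¹ x<)) (s≤s⁻¹ (s≤s⁻¹ y<))

  drawn-valid : IsTatamiTiling n n n ts
  drawn-valid = drawn-tiling , drawn-tatami , drawn-monomers

-- The bijection between codes and tilings

_≟ˢ_ : DecidableEquality Shape
monomer         ≟ˢ monomer         = yes refl
monomer         ≟ˢ horizontalDimer = no λ ()
monomer         ≟ˢ verticalDimer   = no λ ()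
horizontalDimer ≟ˢ monomer         = no λ ()
horizontalDimer ≟ˢ horizontalDimer = yes refl
horizontalDimer ≟ˢ verticalDimer   = no λ ()
verticalDimer   ≟ˢ monomer         = no λ ()
verticalDimer   ≟ˢ horizontalDimer = no λ ()
verticalDimer   ≟ˢ verticalDimer   = yes refl

_≟ᵗ_ : DecidableEquality Tile
tile i j s ≟ᵗ tile i′ j′ s′ with i ≟ i′ | j ≟ j′ | s ≟ˢ s′
... | yes refl | yes refl | yes refl = yes refl
... | no i≢    | _        | _        = no λ { refl → i≢ refl }
... | _        | no j≢    | _        = no λ { refl → j≢ refl }
... | _        | _        | no s≢    = no λ { refl → s≢ refl }

open DecMembership _≟ᵗ_ using (_∈?_)

guard-cong : ∀ {P : Set} (P? : Dec P) {a b} → (P → a ≡ b) → does P? ∧ a ≡ does P? ∧ b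
guard-cong (yes p) eq = eq p
guard-cong (no _)  _  = refl

twist-agree : ∀ {M F F′} → Agree M (twist F) F′ → Agree M F (twist F′)
twist-agree {F = F} ag x y x≤ y≤ =
  trans (sym (twist-involutive F x y)) (cong (_xor odd (x + y)) (ag x y x≤ y≤))

module _ {M : ℕ} {χ : Tile → Bool} {h g : Field}
         (valid : IsTatamiTiling (suc (suc M)) (suc (suc M)) (suc (suc M)) (tiles M χ))
         (arms : ∀ a b → a ≤ M → b ≤ M → Arms (horiz M χ) (vert M χ) h g a b) where

  private
    N = suc M
    n = suc N
    H = horiz M χ
    V = vert M χ

  raw≡horiz : ∀ i j → i ≤ N → j ≤ M → rawH M h g i j ≡ H i j
  raw≡horiz zero    j _  j≤ = proj₁ (arms 0 j z≤n j≤)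
  raw≡horiz (suc i) j i≤ j≤ = proj₁ (proj₂ (arms i j (s≤s⁻¹ i≤) j≤))

  raw≡vert : ∀ i j → i ≤ M → j ≤ N → rawV M h g i j ≡ V i j
  raw≡vert i zero    i≤ _  = proj₁ (proj₂ (proj₂ (arms i 0 i≤ z≤n)))
  raw≡vert i (suc j) i≤ j≤ = proj₂ (proj₂ (proj₂ (arms i j i≤ (s≤s⁻¹ j≤))))

  drawn≡horiz : ∀ i j → Fits n n (tile i j horizontalDimer) → rawH M h g i j ≡ χ (tile i j horizontalDimer)
  drawn≡horiz i j fits@(b≤ , r≤) = trans
    (raw≡horiz i j (s≤s⁻¹ (subst (_≤ n) (+-comm i 1) b≤)) (s≤s⁻¹ (s≤s⁻¹ (subst (_≤ n) (+-comm j 2) r≤))))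
    (present-fits χ (tile i j horizontalDimer) fits)

  drawn≡vert : ∀ i j → Fits n n (tile i j verticalDimer) → rawV M h g i j ≡ χ (tile i j verticalDimer)
  drawn≡vert i j fits@(b≤ , r≤) = trans
    (raw≡vert i j (s≤s⁻¹ (s≤s⁻¹ (subst (_≤ n) (+-comm i 2) b≤))) (s≤s⁻¹ (subst (_≤ n) (+-comm j 1) r≤)))
    (present-fits χ (tile i j verticalDimer) fits)

  H⁺≡ : ∀ i j → H⁺ M h g i j ≡ H i j
  H⁺≡ i j = guard-cong (fits? n n (tile i j horizontalDimer)) (drawn≡horiz i j)

  V⁺≡ : ∀ i j → V⁺ M h g i j ≡ V i j
  V⁺≡ i j = guard-cong (fits? n n (tile i j verticalDimer)) (drawn≡vert i j)

  -- The arms recover the dimers, and the dimers determine the monomers because each cell is covered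
  -- exactly once.
  drawn≡ : ∀ t → Fits n n t → drawn M h g t ≡ χ t
  drawn≡ (tile i j horizontalDimer) fits = drawn≡horiz i j fits
  drawn≡ (tile i j verticalDimer)   fits = drawn≡vert i j fits
  drawn≡ (tile i j monomer)         fits@(b≤ , r≤) = trans
    (cong not (cong₂ _∨_ (cong₂ _∨_ (H⁺≡ i j) (shiftRight≡ i j)) (cong₂ _∨_ (V⁺≡ i j) (shiftDown≡ i j))))
    (trans (sym (total≡1⇒monomer (mono M χ i j) (H i j) (shiftRight H i j) (V i j) (shiftDown V i j)
             (valid-cover valid i j (≤-trans (i<i+1 i) b≤) (≤-trans (i<i+1 j) r≤))))
           (present-fits χ (tile i j monomer) fits))
    where
    shiftRight≡ : ∀ i j → shiftRight (H⁺ M h g) i j ≡ shiftRight H i j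
    shiftRight≡ i zero    = refl
    shiftRight≡ i (suc j) = H⁺≡ i j
    shiftDown≡ : ∀ i j → shiftDown (V⁺ M h g) i j ≡ shiftDown V i j
    shiftDown≡ zero    j = refl
    shiftDown≡ (suc i) j = V⁺≡ i j

module _ (M : ℕ) where

  private
    N = suc M
    n = suc N

  encode : Code M → List Tile
  encode c = tiles M (drawn M (twist (codeH c)) (twist (codeG c)))

  encode-valid : ∀ {c} → c ∈ codes M → encode c ∈ subsets (placements n n) × IsTatamiTiling n n n (encode c)
  encode-valid {c} c∈ =
      subst (_∈ subsets (placements n n)) (sym (tiles≡ M χ)) (filter∈subsets (isTrue? χ) (placements n n))
    , drawn-valid (code-aligned c c∈)
    where
    χ = drawn M (twist (codeH c)) (twist (codeG c))

  -- The list is rewritten as `tiles M χ` for its characteristic function χ, to which the results on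
  -- fields apply. The code read off from them draws a function χ′ that agrees with χ on all tiles
  -- inside the grid, hence the same list.
  encode-surjective : ∀ {ts} → ts ∈ subsets (placements n n) → IsTatamiTiling n n n ts →
                      ∃ λ c → c ∈ codes M × ts ≡ encode c
  encode-surjective {ts} ts∈ ts-valid = c , twisted-code∈ twisted , trans
    (subset≡filter (isTrue? χ′) (placements-unique n n) ts∈
      (λ {t} t∈ t∈ts → trans (agree t (∈-placements⁻ t∈)) (dec-true (t ∈? ts) t∈ts))
      (λ {t} t∈ on → does⇒ (t ∈? ts) (trans (sym (agree t (∈-placements⁻ t∈))) on)))
    (sym (tiles≡ M χ′))
    where
    χ : Tile → Bool
    χ t = does (t ∈? ts)
    ts≡ : ts ≡ tiles M χ
    ts≡ = trans (subset≡filter (isTrue? χ) (placements-unique n n) ts∈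
      (λ {t} _ → dec-true (t ∈? ts)) (λ {t} _ → does⇒ (t ∈? ts))) (sym (tiles≡ M χ))
    valid : IsTatamiTiling n n n (tiles M χ)
    valid = subst (IsTatamiTiling n n n) ts≡ ts-valid
    tatami = valid⇒tatamiField {M} {χ} valid
    extremal = valid⇒extremal {M} {χ} valid
    h = DL tatami extremal
    g = DR tatami
    twisted : Twisted M (twist h) (twist g)
    twisted = aligned⇒twisted (tatami-aligned tatami extremal)
    c = twisted-code twisted
    χ′ = drawn M (twist (codeH c)) (twist (codeG c))
    h≡ : Agree M h (twist (codeH c))
    h≡ = twist-agree {F = h} (twisted-codeH twisted)
    g≡ : Agree M g (twist (codeG c))
    g≡ = twist-agree {F = g} (twisted-codeG twisted)
    agree : ∀ t → Fits n n t → χ′ t ≡ χ t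
    agree = drawn≡ {M} {χ} {twist (codeH c)} {twist (codeG c)} valid λ a b a≤ b≤ →
      subst₂ (λ x y → Arms (horiz M χ) (vert M χ) (λ _ _ → x) (λ _ _ → y) a b)
        (h≡ a b a≤ b≤) (g≡ a b a≤ b≤) (arms tatami extremal a b a≤ b≤)

  -- Equal lists have equal arms at every interior point. The arms determine both bits, and the
  -- twist cancels.
  encode-injective : ∀ {c c′} → c ∈ codes M → c′ ∈ codes M → encode c ≡ encode c′ → c ≡ c′
  encode-injective {c} {c′} c∈ c′∈ eq = code-injective c c′
    (λ a b a≤ b≤ → xor-cancel (odd (a + b)) (proj₁ (same a b a≤ b≤)))
    (λ a b a≤ b≤ → xor-cancel (odd (a + b)) (proj₂ (same a b a≤ b≤)))
    where
    χ  = drawn M (twist (codeH c)) (twist (codeG c))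
    χ′ = drawn M (twist (codeH c′)) (twist (codeG c′))
    present≡ : ∀ t → present M χ t ≡ present M χ′ t
    present≡ t = true⇔⇒≡
      (λ on → ∈-tiles⇒present M χ′ (subst (t ∈_) eq (∈-tiles⁺ M χ on)))
      (λ on → ∈-tiles⇒present M χ (subst (t ∈_) (sym eq) (∈-tiles⁺ M χ′ on)))
    same : ∀ a b → a ≤ M → b ≤ M →
           twist (codeH c) a b ≡ twist (codeH c′) a b × twist (codeG c) a b ≡ twist (codeG c′) a b
    same a b a≤ b≤ =
      let u , d , l , _ = drawn-arms (code-aligned c c∈) a b a≤ b≤
          u′ , d′ , l′ , _ = drawn-arms (code-aligned c′ c′∈) a b a≤ b≤
      in arms-injective _ _ _ _
           (trans u (trans (present≡ (tile a b horizontalDimer)) (sym u′)))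
           (trans d (trans (present≡ (tile (suc a) b horizontalDimer)) (sym d′)))
           (trans l (trans (present≡ (tile a b verticalDimer)) (sym l′)))
    xor-cancel : ∀ {x y} k → x xor k ≡ y xor k → x ≡ y
    xor-cancel {true}  {true}  k _ = refl
    xor-cancel {false} {false} k _ = refl
    xor-cancel {true}  {false} true  ()
    xor-cancel {true}  {false} false ()
    xor-cancel {false} {true}  true  ()
    xor-cancel {false} {true}  false ()

theorem2 : ∀ (n : ℕ) → n ≥ 1 → T n n n ≡ n * 2 ^ (n ∸ 1)
-- The 1 × 1 grid has no interior point and does not fit n = M + 2; it is settled by evaluation.
theorem2 (suc zero)    _ = refl
theorem2 (suc (suc M)) _ = trans
  (count-subsets (isTatamiTiling? n n n) (encode M) (placements-unique n n) (codes-unique M)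
    (encode-valid M) (encode-surjective M) (encode-injective M))
  (length-codes M)
  where n = suc (suc M)
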